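{- Let $n\ge 3$ be an odd integer and $G=\langle\sigma,\tau:\sigma^n=\tau^2=1,\ \tau\sigma\tau^{ -1}=\sigma^{ -1}\rangle\simeq D_n$. Then there is an isomorphism of $G$-lattices $\widetilde{M}_+\oplus\mathbb{Z}\simeq\mathbb{Z}[G/\langle\sigma\rangle]\oplus\mathbb{Z}[G/\langle\tau\rangle]$.
   Context: $D_n$ is the dihedral group of order $2n$. A $G$-lattice is a finitely generated $\mathbb{Z}[G]$-module that is torsion-free as an abelian group; $\mathbb{Z}$ denotes the rank-one lattice with trivial $G$-action, and for a subgroup $S\le G$, $\mathbb{Z}[G/S]$ is the permutation lattice on the left cosets of $S$. The $G$-lattice $\widetilde{M}_+$ of rank $n+1$ is the free abelian group with basis $w_0,\ldots,w_{n-1},w$ (indices modulo $n$) and action $\sigma\cdot w_i=w_{i+1}$, $\tau\cdot w_i=w_{ -i}$, $\sigma\cdot w=w$, $\tau\cdot w=-w+\sum_{0\le i\le n-1}w_i$. -}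

module Defs where

open import Algebra.Bundles using (Group; AbelianGroup; Ring)
open import Algebra.Core using (Op₂)
import Algebra.Definitions.RawMonoid as RawMonoidDefinitions
import Algebra.Module.Construct.DirectProduct as DirectProduct
open import Algebra.Module.Bundles using (LeftModule)
open import Algebra.Module.Morphism.Structures using (module LeftModuleMorphisms)
import Algebra.Properties.AbelianGroup as AbelianGroupProperties
import Algebra.Properties.CommutativeMonoid.Sum as Sum
import Algebra.Properties.Group as GroupProperties
open import Data.Bool.Base using (if_then_else_)
open import Data.Fin.Base as Fin using (Fin; zero; suc; toℕ; fromℕ<; opposite; inject₁; punchIn)
import Data.Fin.Permutation as Perm
import Data.Fin.Properties as Fin
open import Data.Integer.Base as ℤ using (ℤ; +_; -[1+_]; 0ℤ; 1ℤ)
import Data.Integer.DivMod as ℤ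
open import Data.Integer.Divisibility.Signed as ℤ using (_∣_; divides)
import Data.Integer.Properties as ℤ
open import Data.Integer.Tactic.RingSolver using (solve-∀)
open import Data.Nat.Base as ℕ using (ℕ; zero; suc; NonZero)
import Data.Nat.Divisibility as ℕ
import Data.Nat.Properties as ℕ
open import Data.Product.Base using (Σ-syntax; ∃-syntax; _×_; _,_; proj₁; proj₂)
open import Data.Sign.Base as Sign using (Sign)
import Data.Sign.Properties as Sign
open import Data.Sum.Base using (inj₁; inj₂)
open import Data.Vec.Functional using (Vector; removeAt; _++_)
open import Function.Base using (_∘_; id)
open import Level using (0ℓ)
open import Relation.Binary.Bundles using (Setoid)
open import Relation.Binary.Core using (Rel)
open import Relation.Binary.PropositionalEquality.Core as ≡ using (_≡_)
import Relation.Binary.PropositionalEquality.Properties as ≡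
import Relation.Binary.Reasoning.Setoid as SetoidReasoning
open import Relation.Nullary.Decidable using (yes; no; does)
open import Relation.Nullary.Negation using (contradiction)
open import Relation.Unary using (Pred)

------------------------------------------------------------------------
-- Integer powers in a group

module Power (H : Group 0ℓ 0ℓ) where
  open Group H
  open GroupProperties H
  open SetoidReasoning setoid

  infixl 8 _^ℕ_ _^_

  _^ℕ_ : Carrier → ℕ → Carrier
  x ^ℕ zero  = ε
  x ^ℕ suc k = x ∙ x ^ℕ k

  _^_ : Carrier → ℤ → Carrier
  x ^ (+ k)    = x ^ℕ k
  x ^ -[1+ k ] = (x ^ℕ suc k) ⁻¹

  ^ℕ-comm : ∀ x k → x ∙ x ^ℕ k ≈ x ^ℕ k ∙ x
  ^ℕ-comm x zero    = trans (identityʳ x) (sym (identityˡ x))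
  ^ℕ-comm x (suc k) = trans (∙-congˡ (^ℕ-comm x k)) (sym (assoc _ _ _))

  ^-suc : ∀ x a → x ^ (ℤ.suc a) ≈ x ∙ x ^ a
  ^-suc x (+ k)          = refl
  ^-suc x -[1+ zero ]    = sym (trans (∙-congˡ (⁻¹-cong (identityʳ x))) (inverseʳ x))
  ^-suc x -[1+ (suc k) ] = sym (begin
    x ∙ (x ∙ x ^ℕ suc k) ⁻¹        ≈⟨ ∙-congˡ (⁻¹-cong (^ℕ-comm x (suc k))) ⟩
    x ∙ (x ^ℕ suc k ∙ x) ⁻¹        ≈⟨ ∙-congˡ (⁻¹-anti-homo-∙ _ _) ⟩
    x ∙ (x ⁻¹ ∙ (x ^ℕ suc k) ⁻¹)   ≈⟨ assoc _ _ _ ⟨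
    (x ∙ x ⁻¹) ∙ (x ^ℕ suc k) ⁻¹   ≈⟨ ∙-congʳ (inverseʳ x) ⟩
    ε ∙ (x ^ℕ suc k) ⁻¹            ≈⟨ identityˡ _ ⟩
    (x ^ℕ suc k) ⁻¹                ∎)

  ^-≡ : ∀ x {a b} → a ≡ b → x ^ a ≈ x ^ b
  ^-≡ x ≡.refl = refl

  ^-homo-+ : ∀ x a b → x ^ (a ℤ.+ b) ≈ x ^ a ∙ x ^ b
  ^-homo-+ x (+ zero)  b = trans (^-≡ x (ℤ.+-identityˡ b)) (sym (identityˡ _))
  ^-homo-+ x (+ suc k) b = begin
    x ^ (+ suc k ℤ.+ b)        ≈⟨ ^-≡ x (ℤ.+-assoc 1ℤ (+ k) b) ⟩
    x ^ (ℤ.suc (+ k ℤ.+ b))    ≈⟨ ^-suc x (+ k ℤ.+ b) ⟩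
    x ∙ x ^ (+ k ℤ.+ b)        ≈⟨ ∙-congˡ (^-homo-+ x (+ k) b) ⟩
    x ∙ (x ^ (+ k) ∙ x ^ b)    ≈⟨ assoc _ _ _ ⟨
    x ^ (+ suc k) ∙ x ^ b      ∎
  ^-homo-+ x -[1+ zero ] b = begin
    x ^ (-[1+ 0 ] ℤ.+ b)                        ≈⟨ identityˡ _ ⟨
    ε ∙ x ^ (-[1+ 0 ] ℤ.+ b)                    ≈⟨ ∙-congʳ (inverseˡ (x ∙ ε)) ⟨
    (x ∙ ε) ⁻¹ ∙ (x ∙ ε) ∙ x ^ (-[1+ 0 ] ℤ.+ b) ≈⟨ assoc _ _ _ ⟩
    (x ∙ ε) ⁻¹ ∙ ((x ∙ ε) ∙ x ^ (-[1+ 0 ] ℤ.+ b)) ≈⟨ ∙-congˡ (∙-congʳ (identityʳ x)) ⟩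
    (x ∙ ε) ⁻¹ ∙ (x ∙ x ^ (-[1+ 0 ] ℤ.+ b))     ≈⟨ ∙-congˡ (^-suc x (-[1+ 0 ] ℤ.+ b)) ⟨
    (x ∙ ε) ⁻¹ ∙ x ^ (ℤ.suc (-[1+ 0 ] ℤ.+ b))   ≈⟨ ∙-congˡ (^-≡ x (ℤ.suc-pred b)) ⟩
    (x ∙ ε) ⁻¹ ∙ x ^ b                          ∎
  ^-homo-+ x -[1+ suc k ] b = begin
    x ^ (-[1+ suc k ] ℤ.+ b)                   ≈⟨ ^-≡ x (ℤ.+-assoc (ℤ.- 1ℤ) -[1+ k ] b) ⟩
    x ^ (ℤ.- 1ℤ ℤ.+ (-[1+ k ] ℤ.+ b))          ≈⟨ ^-homo-+ x -[1+ 0 ] (-[1+ k ] ℤ.+ b) ⟩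
    x ^ (ℤ.- 1ℤ) ∙ x ^ (-[1+ k ] ℤ.+ b)        ≈⟨ ∙-congˡ (^-homo-+ x -[1+ k ] b) ⟩
    x ^ (ℤ.- 1ℤ) ∙ (x ^ -[1+ k ] ∙ x ^ b)      ≈⟨ assoc _ _ _ ⟨
    x ^ (ℤ.- 1ℤ) ∙ x ^ -[1+ k ] ∙ x ^ b        ≈⟨ ∙-congʳ (^-homo-+ x (ℤ.- 1ℤ) -[1+ k ]) ⟨
    x ^ -[1+ suc k ] ∙ x ^ b                   ∎

  ^-neg : ∀ x a → x ^ (ℤ.- a) ≈ (x ^ a) ⁻¹
  ^-neg x a = inverseˡ-unique _ _
    (trans (sym (^-homo-+ x (ℤ.- a) a)) (^-≡ x (ℤ.+-inverseˡ a)))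

  ^ℕ-cong : ∀ k {x y} → x ≈ y → x ^ℕ k ≈ y ^ℕ k
  ^ℕ-cong zero    e = refl
  ^ℕ-cong (suc k) e = ∙-cong e (^ℕ-cong k e)

  ^-cong : ∀ a {x y} → x ≈ y → x ^ a ≈ y ^ a
  ^-cong (+ k)    e = ^ℕ-cong k e
  ^-cong -[1+ k ] e = ⁻¹-cong (^ℕ-cong (suc k) e)

  ^-zero-*ℕ : ∀ x n → x ^ (+ n) ≈ ε → ∀ k → x ^ (+ k ℤ.* + n) ≈ ε
  ^-zero-*ℕ x n e zero    = refl
  ^-zero-*ℕ x n e (suc k) = begin
    x ^ (+ suc k ℤ.* + n)            ≈⟨ ^-≡ x (ℤ.suc-* (+ k) (+ n)) ⟩
    x ^ (+ n ℤ.+ + k ℤ.* + n)        ≈⟨ ^-homo-+ x (+ n) (+ k ℤ.* + n) ⟩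
    x ^ (+ n) ∙ x ^ (+ k ℤ.* + n)    ≈⟨ ∙-cong e (^-zero-*ℕ x n e k) ⟩
    ε ∙ ε                            ≈⟨ identityˡ ε ⟩
    ε                                ∎

  ^-zero-* : ∀ x n → x ^ (+ n) ≈ ε → ∀ q → x ^ (q ℤ.* + n) ≈ ε
  ^-zero-* x n e (+ k)    = ^-zero-*ℕ x n e k
  ^-zero-* x n e -[1+ k ] = begin
    x ^ (-[1+ k ] ℤ.* + n)           ≈⟨ ^-≡ x (≡.sym (ℤ.neg-distribˡ-* (+ suc k) (+ n))) ⟩
    x ^ (ℤ.- (+ suc k ℤ.* + n))      ≈⟨ ^-neg x (+ suc k ℤ.* + n) ⟩
    (x ^ (+ suc k ℤ.* + n)) ⁻¹       ≈⟨ ⁻¹-cong (^-zero-*ℕ x n e (suc k)) ⟩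
    ε ⁻¹                             ≈⟨ ε⁻¹≈ε ⟩
    ε                                ∎

------------------------------------------------------------------------
-- Additive maps and automorphisms of abelian groups

record Additive (A B : AbelianGroup 0ℓ 0ℓ) : Set where
  private
    module A = AbelianGroup A
    module B = AbelianGroup B
  field
    fun  : A.Carrier → B.Carrier
    cong : ∀ {x y} → x A.≈ y → fun x B.≈ fun y
    homo : ∀ x y → fun (x A.∙ y) B.≈ fun x B.∙ fun y

  private
    module AP = Power A.group
    module BP = Power B.group
  open GroupProperties B.group
  open SetoidReasoning B.setoid

  ε-homo : fun A.ε B.≈ B.ε
  ε-homo = begin
    fun A.ε                                       ≈⟨ B.identityˡ _ ⟨
    B.ε B.∙ fun A.ε                               ≈⟨ B.∙-congʳ (B.inverseˡ _) ⟨
    (fun A.ε) B.⁻¹ B.∙ fun A.ε B.∙ fun A.ε        ≈⟨ B.assoc _ _ _ ⟩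
    (fun A.ε) B.⁻¹ B.∙ (fun A.ε B.∙ fun A.ε)      ≈⟨ B.∙-congˡ (homo _ _) ⟨
    (fun A.ε) B.⁻¹ B.∙ fun (A.ε A.∙ A.ε)          ≈⟨ B.∙-congˡ (cong (A.identityˡ _)) ⟩
    (fun A.ε) B.⁻¹ B.∙ fun A.ε                    ≈⟨ B.inverseˡ _ ⟩
    B.ε                                           ∎

  ⁻¹-homo : ∀ x → fun (x A.⁻¹) B.≈ (fun x) B.⁻¹
  ⁻¹-homo x = inverseˡ-unique _ _
    (B.trans (B.sym (homo _ _)) (B.trans (cong (A.inverseˡ x)) ε-homo))

  ^ℕ-homo : ∀ x k → fun (x AP.^ℕ k) B.≈ fun x BP.^ℕ k
  ^ℕ-homo x zero    = ε-homo
  ^ℕ-homo x (suc k) = B.trans (homo _ _) (B.∙-congˡ (^ℕ-homo x k))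

  ^-homo : ∀ x a → fun (x AP.^ a) B.≈ fun x BP.^ a
  ^-homo x (+ k)    = ^ℕ-homo x k
  ^-homo x -[1+ k ] = B.trans (⁻¹-homo _) (B.⁻¹-cong (^ℕ-homo x (suc k)))

idᴬ : ∀ {A} → Additive A A
idᴬ {A} = record { fun = id ; cong = id ; homo = λ _ _ → AbelianGroup.refl A }

_∘ᴬ_ : ∀ {A B C} → Additive B C → Additive A B → Additive A C
_∘ᴬ_ {C = C} f g = record
  { fun  = f.fun ∘ g.fun
  ; cong = f.cong ∘ g.cong
  ; homo = λ x y → AbelianGroup.trans C (f.cong (g.homo x y)) (f.homo _ _)
  } where module f = Additive f; module g = Additive g

record Automorphism (A : AbelianGroup 0ℓ 0ℓ) : Set where
  open AbelianGroup A
  field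
    to      : Additive A A
    from    : Additive A A
    to∘from : ∀ x → Additive.fun to (Additive.fun from x) ≈ x
    from∘to : ∀ x → Additive.fun from (Additive.fun to x) ≈ x

  open Additive to public
  module From = Additive from

Aut : AbelianGroup 0ℓ 0ℓ → Group 0ℓ 0ℓ
Aut A = record
  { Carrier = Automorphism A
  ; _≈_     = λ f g → ∀ x → fun f x ≈ fun g x
  ; _∙_     = λ f g → record
    { to      = to f ∘ᴬ to g
    ; from    = from g ∘ᴬ from f
    ; to∘from = λ x → trans (cong f (to∘from g _)) (to∘from f x)
    ; from∘to = λ x → trans (From.cong g (from∘to f _)) (from∘to g x)
    }
  ; ε       = record { to = idᴬ ; from = idᴬ ; to∘from = λ _ → refl ; from∘to = λ _ → refl }
  ; _⁻¹     = λ f → record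
    { to = from f ; from = to f ; to∘from = from∘to f ; from∘to = to∘from f }
  ; isGroup = record
    { isMonoid = record
      { isSemigroup = record
        { isMagma = record
          { isEquivalence = record
            { refl  = λ _ → refl
            ; sym   = λ p x → sym (p x)
            ; trans = λ p q x → trans (p x) (q x)
            }
          ; ∙-cong = λ {f} {f′} {g} {g′} p q x → trans (cong f (q x)) (p _)
          }
        ; assoc = λ _ _ _ _ → refl
        }
      ; identity = (λ _ _ → refl) , (λ _ _ → refl)
      }
    ; inverse = from∘to , to∘from
    ; ⁻¹-cong = λ {f} {g} p x →
        trans (From.cong f (sym (to∘from g x)))
        (trans (From.cong f (sym (p _))) (from∘to f _))
    }
  } where open AbelianGroup A; open Automorphism

------------------------------------------------------------------------
-- The free abelian group on a setoid: formal ℤ-combinations of elements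
-- modulo the least congruence containing the abelian group laws and the
-- equality of the setoid.

infixl 6 _⊕_
infix  8 ⊖_

data Comb (A : Set) : Set where
  [_] : A → Comb A
  𝟘   : Comb A
  _⊕_ : Comb A → Comb A → Comb A
  ⊖_  : Comb A → Comb A

module _ (X : Setoid 0ℓ 0ℓ) where
  private module X = Setoid X

  data CombEq : Rel (Comb X.Carrier) 0ℓ where
    []-cong   : ∀ {x y} → x X.≈ y → CombEq [ x ] [ y ]
    refl      : ∀ {s} → CombEq s s
    sym       : ∀ {s t} → CombEq s t → CombEq t s
    trans     : ∀ {s t u} → CombEq s t → CombEq t u → CombEq s u
    ⊕-cong    : ∀ {s s′ t t′} → CombEq s s′ → CombEq t t′ → CombEq (s ⊕ t) (s′ ⊕ t′)
    ⊖-cong    : ∀ {s t} → CombEq s t → CombEq (⊖ s) (⊖ t)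
    assoc     : ∀ s t u → CombEq ((s ⊕ t) ⊕ u) (s ⊕ (t ⊕ u))
    comm      : ∀ s t → CombEq (s ⊕ t) (t ⊕ s)
    identityˡ : ∀ s → CombEq (𝟘 ⊕ s) s
    inverseˡ  : ∀ s → CombEq (⊖ s ⊕ s) 𝟘

  freeAbelianGroup : AbelianGroup 0ℓ 0ℓ
  freeAbelianGroup = record
    { Carrier = Comb X.Carrier
    ; _≈_     = CombEq
    ; _∙_     = _⊕_
    ; ε       = 𝟘
    ; _⁻¹     = ⊖_
    ; isAbelianGroup = record
      { isGroup = record
        { isMonoid = record
          { isSemigroup = record
            { isMagma = record
              { isEquivalence = record { refl = refl ; sym = sym ; trans = trans }
              ; ∙-cong = ⊕-cong
              }
            ; assoc = assoc
            }
          ; identity = identityˡ , λ s → trans (comm s 𝟘) (identityˡ s)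
          }
        ; inverse = inverseˡ , λ s → trans (comm s (⊖ s)) (inverseˡ s)
        ; ⁻¹-cong = ⊖-cong
        }
      ; comm = comm
      }
    }

module _ (B : AbelianGroup 0ℓ 0ℓ) where
  private module B = AbelianGroup B
  open AbelianGroupProperties B using (⁻¹-∙-comm)
  open GroupProperties B.group using (ε⁻¹≈ε)

  -- ℤ-linear extension of f.
  extend : {A : Set} → (A → B.Carrier) → Comb A → B.Carrier
  extend f [ x ]   = f x
  extend f 𝟘       = B.ε
  extend f (s ⊕ t) = extend f s B.∙ extend f t
  extend f (⊖ s)   = (extend f s) B.⁻¹

  extend-cong : (X : Setoid 0ℓ 0ℓ) {f : Setoid.Carrier X → B.Carrier} →
                (∀ {x y} → Setoid._≈_ X x y → f x B.≈ f y) →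
                ∀ {s t} → CombEq X s t → extend f s B.≈ extend f t
  extend-cong X f-cong ([]-cong e)   = f-cong e
  extend-cong X f-cong refl          = B.refl
  extend-cong X f-cong (sym p)       = B.sym (extend-cong X f-cong p)
  extend-cong X f-cong (trans p q)   = B.trans (extend-cong X f-cong p) (extend-cong X f-cong q)
  extend-cong X f-cong (⊕-cong p q)  = B.∙-cong (extend-cong X f-cong p) (extend-cong X f-cong q)
  extend-cong X f-cong (⊖-cong p)    = B.⁻¹-cong (extend-cong X f-cong p)
  extend-cong X f-cong (assoc s t u) = B.assoc _ _ _
  extend-cong X f-cong (comm s t)    = B.comm _ _
  extend-cong X f-cong (identityˡ s) = B.identityˡ _
  extend-cong X f-cong (inverseˡ s)  = B.inverseˡ _

  extend-ext : {A : Set} {f g : A → B.Carrier} → (∀ x → f x B.≈ g x) →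
               ∀ s → extend f s B.≈ extend g s
  extend-ext e [ x ]   = e x
  extend-ext e 𝟘       = B.refl
  extend-ext e (s ⊕ t) = B.∙-cong (extend-ext e s) (extend-ext e t)
  extend-ext e (⊖ s)   = B.⁻¹-cong (extend-ext e s)

  extend-+ : {A : Set} (f g : A → B.Carrier) →
             ∀ s → extend (λ x → f x B.∙ g x) s B.≈ extend f s B.∙ extend g s
  extend-+ f g [ x ]   = B.refl
  extend-+ f g 𝟘       = B.sym (B.identityˡ _)
  extend-+ f g (s ⊕ t) = B.trans (B.∙-cong (extend-+ f g s) (extend-+ f g t))
    (B.trans (B.assoc _ _ _) (B.trans (B.∙-congˡ (B.trans (B.sym (B.assoc _ _ _))
      (B.trans (B.∙-congʳ (B.comm _ _)) (B.assoc _ _ _)))) (B.sym (B.assoc _ _ _))))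
  extend-+ f g (⊖ s)   = B.trans (B.⁻¹-cong (extend-+ f g s)) (B.sym (⁻¹-∙-comm _ _))

  extend-ε : {A : Set} → ∀ (s : Comb A) → extend (λ _ → B.ε) s B.≈ B.ε
  extend-ε [ x ]   = B.refl
  extend-ε 𝟘       = B.refl
  extend-ε (s ⊕ t) = B.trans (B.∙-cong (extend-ε s) (extend-ε t)) (B.identityˡ _)
  extend-ε (⊖ s)   = B.trans (B.⁻¹-cong (extend-ε s)) ε⁻¹≈ε

  extendᴬ : (X : Setoid 0ℓ 0ℓ) (f : Setoid.Carrier X → B.Carrier) →
            (∀ {x y} → Setoid._≈_ X x y → f x B.≈ f y) → Additive (freeAbelianGroup X) B
  extendᴬ X f f-cong = record
    { fun = extend f ; cong = extend-cong X f-cong ; homo = λ _ _ → B.refl }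

  -- Additive maps agreeing on the basis agree.
  additive-ext : (X : Setoid 0ℓ 0ℓ) (φ ψ : Additive (freeAbelianGroup X) B) →
                 (∀ x → Additive.fun φ [ x ] B.≈ Additive.fun ψ [ x ]) →
                 ∀ s → Additive.fun φ s B.≈ Additive.fun ψ s
  additive-ext X φ ψ e = go
    where
    module φ = Additive φ
    module ψ = Additive ψ
    go : ∀ s → φ.fun s B.≈ ψ.fun s
    go [ x ]   = e x
    go 𝟘       = B.trans φ.ε-homo (B.sym ψ.ε-homo)
    go (s ⊕ t) = B.trans (φ.homo s t) (B.trans (B.∙-cong (go s) (go t)) (B.sym (ψ.homo s t)))
    go (⊖ s)   = B.trans (φ.⁻¹-homo s) (B.trans (B.⁻¹-cong (go s)) (B.sym (ψ.⁻¹-homo s)))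

------------------------------------------------------------------------
-- Group actions, the integral group ring, and ℤ[G]-modules

module _ (G : Group 0ℓ 0ℓ) where
  private module G = Group G

  record GSet (X : Setoid 0ℓ 0ℓ) : Set where
    open Setoid X
    infixr 7 _·_
    field
      _·_        : G.Carrier → Carrier → Carrier
      ·-cong     : ∀ {g h x y} → g G.≈ h → x ≈ y → g · x ≈ h · y
      ·-identity : ∀ x → G.ε · x ≈ x
      ·-assoc    : ∀ g h x → (g G.∙ h) · x ≈ g · h · x

  record LinearAction (A : AbelianGroup 0ℓ 0ℓ) : Set where
    open AbelianGroup A
    field
      gset   : GSet setoid
    open GSet gset public
    field
      ·-homo : ∀ g x y → g · (x ∙ y) ≈ (g · x) ∙ (g · y)

    ·ᴬ : G.Carrier → Additive A A
    ·ᴬ g = record { fun = g ·_ ; cong = ·-cong G.refl ; homo = ·-homo g }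

  linearise : (X : Setoid 0ℓ 0ℓ) → GSet X → LinearAction (freeAbelianGroup X)
  linearise X action = record
    { gset = record
      { _·_        = λ g → extend F (λ x → [ g · x ])
      ; ·-cong     = λ {g} {h} {s} {t} p q → trans
          (extend-cong F X (λ e → []-cong (·-cong G.refl e)) q)
          (extend-ext F (λ x → []-cong (·-cong p X.refl)) t)
      ; ·-identity = additive-ext F X
          (extendᴬ F X _ (λ e → []-cong (·-cong G.refl e))) idᴬ (λ x → []-cong (·-identity x))
      ; ·-assoc    = λ g h → additive-ext F X
          (extendᴬ F X _ (λ e → []-cong (·-cong G.refl e)))
          (extendᴬ F X _ (λ e → []-cong (·-cong G.refl e)) ∘ᴬ
           extendᴬ F X _ (λ e → []-cong (·-cong G.refl e)))
          (λ x → []-cong (·-assoc g h x))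
      }
    ; ·-homo = λ _ _ _ → refl
    }
    where
    open GSet action
    module X = Setoid X
    F = freeAbelianGroup X

  leftTranslation : GSet G.setoid
  leftTranslation = record
    { _·_ = G._∙_ ; ·-cong = G.∙-cong ; ·-identity = G.identityˡ ; ·-assoc = G.assoc }

  ℤG : AbelianGroup 0ℓ 0ℓ
  ℤG = freeAbelianGroup G.setoid

  module Linear {A : AbelianGroup 0ℓ 0ℓ} (action : LinearAction A) where
    private module A = AbelianGroup A
    open LinearAction action
    open SetoidReasoning A.setoid

    infixr 7 _⋆_

    _⋆_ : Comb G.Carrier → A.Carrier → A.Carrier
    r ⋆ a = extend A (_· a) r

    ⋆-cong : ∀ {r s a b} → CombEq G.setoid r s → a A.≈ b → r ⋆ a A.≈ s ⋆ b
    ⋆-cong {r} {s} p q = A.trans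
      (extend-cong A G.setoid (λ e → ·-cong e A.refl) p)
      (extend-ext A (λ g → ·-cong G.refl q) s)

    ⋆-distribˡ : ∀ r a b → r ⋆ (a A.∙ b) A.≈ (r ⋆ a) A.∙ (r ⋆ b)
    ⋆-distribˡ r a b = A.trans (extend-ext A (λ g → ·-homo g a b) r) (extend-+ A (_· a) (_· b) r)

    ⋆-zeroʳ : ∀ r → r ⋆ A.ε A.≈ A.ε
    ⋆-zeroʳ r = A.trans (extend-ext A (λ g → Additive.ε-homo (·ᴬ g)) r) (extend-ε A r)

    ⋆-identityˡ : ∀ a → [ G.ε ] ⋆ a A.≈ a
    ⋆-identityˡ = ·-identity

    ⋆ᴬ : A.Carrier → Additive ℤG A
    ⋆ᴬ a = extendᴬ A G.setoid (_· a) (λ e → ·-cong e A.refl)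

    ⋆-right : Comb G.Carrier → Additive A A
    ⋆-right r = record { fun = r ⋆_ ; cong = ⋆-cong {r} refl ; homo = ⋆-distribˡ r }

  private module T = Linear (linearise G.setoid leftTranslation)

  -- The integral group ring, with (Σ aᵢ gᵢ)(Σ bⱼ hⱼ) = Σ aᵢ bⱼ (gᵢ ∙ hⱼ).
  infixl 7 _*_
  _*_ : Op₂ (Comb G.Carrier)
  r * s = extend ℤG (λ g → extend ℤG (λ h → [ g G.∙ h ]) s) r

  module _ {A : AbelianGroup 0ℓ 0ℓ} (action : LinearAction A) where
    private module A = AbelianGroup A
    open LinearAction action
    open Linear action

    ⋆-assoc : ∀ r s a → (r * s) ⋆ a A.≈ r ⋆ (s ⋆ a)
    ⋆-assoc [ g ] s a = additive-ext A G.setoid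
      (⋆ᴬ a ∘ᴬ T.⋆-right [ g ]) (·ᴬ g ∘ᴬ ⋆ᴬ a) (λ h → ·-assoc g h a) s
    ⋆-assoc 𝟘         s a = A.refl
    ⋆-assoc (r ⊕ r′)  s a = A.∙-cong (⋆-assoc r s a) (⋆-assoc r′ s a)
    ⋆-assoc (⊖ r)     s a = A.⁻¹-cong (⋆-assoc r s a)

  ℤ[_] : Ring 0ℓ 0ℓ
  ℤ[_] = record
    { Carrier = Comb G.Carrier
    ; _≈_     = CombEq G.setoid
    ; _+_     = _⊕_
    ; _*_     = _*_
    ; -_      = ⊖_
    ; 0#      = 𝟘
    ; 1#      = [ G.ε ]
    ; isRing  = record
      { +-isAbelianGroup = AbelianGroup.isAbelianGroup ℤG
      ; *-cong     = λ {r} {s} p q → T.⋆-cong {r} {s} p q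
      ; *-assoc    = ⋆-assoc (linearise G.setoid leftTranslation)
      ; *-identity = T.⋆-identityˡ , additive-ext ℤG G.setoid (T.⋆ᴬ [ G.ε ]) idᴬ
                       (λ g → []-cong (G.identityʳ g))
      ; distrib    = T.⋆-distribˡ , λ _ _ _ → refl
      }
    }

  -- A linear action of G, extended by (Σ aᵢ gᵢ) a = Σ aᵢ (gᵢ · a).
  toModule : {A : AbelianGroup 0ℓ 0ℓ} → LinearAction A → LeftModule ℤ[_] 0ℓ 0ℓ
  toModule {A} action = record
    { Carrierᴹ = A.Carrier
    ; _≈ᴹ_ = A._≈_
    ; _+ᴹ_ = A._∙_
    ; _*ₗ_ = _⋆_
    ; 0ᴹ   = A.ε
    ; -ᴹ_  = A._⁻¹
    ; isLeftModule = record
      { isLeftSemimodule = record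
        { +ᴹ-isCommutativeMonoid = A.isCommutativeMonoid
        ; isPreleftSemimodule = record
          { *ₗ-cong      = λ {r} {s} p q → ⋆-cong {r} {s} p q
          ; *ₗ-zeroˡ     = λ _ → A.refl
          ; *ₗ-distribʳ  = λ _ _ _ → A.refl
          ; *ₗ-identityˡ = ⋆-identityˡ
          ; *ₗ-assoc     = ⋆-assoc action
          ; *ₗ-zeroʳ     = ⋆-zeroʳ
          ; *ₗ-distribˡ  = ⋆-distribˡ
          }
        }
      ; -ᴹ‿cong    = A.⁻¹-cong
      ; -ᴹ‿inverse = A.inverse
      }
    }
    where
    module A = AbelianGroup A
    open Linear action

------------------------------------------------------------------------
-- Lattices: finitely generated over ℤ[G], torsion-free as abelian groups

module _ {R : Ring 0ℓ 0ℓ} (M : LeftModule R 0ℓ 0ℓ) where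
  open LeftModule M
  private module M = RawMonoidDefinitions +ᴹ-rawMonoid

  FinitelyGenerated : Set
  FinitelyGenerated =
    ∃[ m ] Σ[ gen ∈ Vector Carrierᴹ m ] ∀ x →
    Σ[ c ∈ Vector (Ring.Carrier R) m ] x ≈ᴹ M.sum (λ i → c i *ₗ gen i)

  TorsionFree : Set
  TorsionFree = ∀ k .{{_ : NonZero k}} x → k M.× x ≈ᴹ 0ᴹ → x ≈ᴹ 0ᴹ

record Lattice (G : Group 0ℓ 0ℓ) : Set₁ where
  field
    leftModule        : LeftModule ℤ[ G ] 0ℓ 0ℓ
    finitelyGenerated : FinitelyGenerated leftModule
    torsionFree       : TorsionFree leftModule
  open LeftModule leftModule public

infix 4 _≅_
_≅_ : {G : Group 0ℓ 0ℓ} → Lattice G → Lattice G → Set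
L ≅ L′ = ∃[ f ] IsLeftModuleIsomorphism f
  where open LeftModuleMorphisms (Lattice.rawLeftModule L) (Lattice.rawLeftModule L′)

module _ {G : Group 0ℓ 0ℓ} where

  infixr 6 _⊞_

  _⊞_ : Lattice G → Lattice G → Lattice G
  L ⊞ L′ = record
    { leftModule        = P
    ; finitelyGenerated = fg L.finitelyGenerated L′.finitelyGenerated
    ; torsionFree       = λ k (x , y) e →
        L.torsionFree k x (L.≈ᴹ-trans (L.≈ᴹ-reflexive (≡.sym (×-proj₁ k x y))) (proj₁ e)) ,
        L′.torsionFree k y (L′.≈ᴹ-trans (L′.≈ᴹ-reflexive (≡.sym (×-proj₂ k x y))) (proj₂ e))
    }
    where
    module L  = Lattice L
    module L′ = Lattice L′
    P = DirectProduct.leftModule L.leftModule L′.leftModule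
    module P  = LeftModule P
    module R = Ring ℤ[ G ]
    module Σ₁ = RawMonoidDefinitions L.+ᴹ-rawMonoid
    module Σ₂ = RawMonoidDefinitions L′.+ᴹ-rawMonoid
    module ΣP = RawMonoidDefinitions P.+ᴹ-rawMonoid

    ×-proj₁ : ∀ k x y → proj₁ (k ΣP.× (x , y)) ≡ k Σ₁.× x
    ×-proj₁ zero    x y = ≡.refl
    ×-proj₁ (suc k) x y = ≡.cong (x L.+ᴹ_) (×-proj₁ k x y)

    ×-proj₂ : ∀ k x y → proj₂ (k ΣP.× (x , y)) ≡ k Σ₂.× y
    ×-proj₂ zero    x y = ≡.refl
    ×-proj₂ (suc k) x y = ≡.cong (y L′.+ᴹ_) (×-proj₂ k x y)

    right : ∀ {m} (g : Vector L′.Carrierᴹ m) (c : Vector R.Carrier m) →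
            ΣP.sum (λ i → c i P.*ₗ (L.0ᴹ , g i)) P.≈ᴹ (L.0ᴹ , Σ₂.sum (λ i → c i L′.*ₗ g i))
    right {zero}  g c = P.≈ᴹ-refl
    right {suc m} g c =
      L.≈ᴹ-trans (L.+ᴹ-cong (L.*ₗ-zeroʳ (c zero)) (proj₁ ih)) (L.+ᴹ-identityˡ _) ,
      L′.+ᴹ-congˡ (proj₂ ih)
      where ih = right (g ∘ suc) (c ∘ suc)

    both : ∀ m {m′} (g : Vector L.Carrierᴹ m) (g′ : Vector L′.Carrierᴹ m′)
           (c : Vector R.Carrier m) (c′ : Vector R.Carrier m′) →
           ΣP.sum {m ℕ.+ m′} (λ i → (c ++ c′) i P.*ₗ ((λ i → g i , L′.0ᴹ) ++ (λ j → L.0ᴹ , g′ j)) i)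
             P.≈ᴹ (Σ₁.sum (λ i → c i L.*ₗ g i) , Σ₂.sum (λ i → c′ i L′.*ₗ g′ i))
    both zero    g g′ c c′ = right g′ c′
    both (suc m) {m′} g g′ c c′ = P.≈ᴹ-trans
      (P.+ᴹ-cong P.≈ᴹ-refl (P.≈ᴹ-trans (P.≈ᴹ-reflexive (sum-≗ _ _ pw)) (both m (g ∘ suc) g′ (c ∘ suc) c′)))
      (L.≈ᴹ-refl , L′.≈ᴹ-trans (L′.+ᴹ-congʳ (L′.*ₗ-zeroʳ (c zero))) (L′.+ᴹ-identityˡ _))
      where
      open Sum P.+ᴹ-commutativeMonoid using (sum-cong-≗)
      sum-≗ : ∀ (s t : Vector P.Carrierᴹ (m ℕ.+ m′)) → (∀ i → s i ≡ t i) → ΣP.sum s ≡ ΣP.sum t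
      sum-≗ s t = sum-cong-≗
      pw : ∀ i → (c ++ c′) (suc i) P.*ₗ ((λ i → g i , L′.0ᴹ) ++ (λ j → L.0ᴹ , g′ j)) (suc i) ≡
                 ((c ∘ suc) ++ c′) i P.*ₗ ((λ i → g (suc i) , L′.0ᴹ) ++ (λ j → L.0ᴹ , g′ j)) i
      pw i with Fin.splitAt m i
      ... | inj₁ _ = ≡.refl
      ... | inj₂ _ = ≡.refl

    fg : FinitelyGenerated L.leftModule → FinitelyGenerated L′.leftModule → FinitelyGenerated P
    fg (m , g , span) (m′ , g′ , span′) =
      m ℕ.+ m′ , ((λ i → g i , L′.0ᴹ) ++ (λ j → L.0ᴹ , g′ j)) , λ (x , y) →
      let c , p = span x ; c′ , p′ = span′ y in
      c ++ c′ , P.≈ᴹ-trans (p , p′) (P.≈ᴹ-sym (both m g g′ c c′))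

------------------------------------------------------------------------
-- The free abelian group on a finite setoid is finitely generated and
-- torsion-free.

-- Only rep (class x) ≈ x is required, so size bounds the number of classes.
record Finite (X : Setoid 0ℓ 0ℓ) : Set where
  open Setoid X
  field
    size       : ℕ
    class      : Carrier → Fin size
    class-cong : ∀ {x y} → x ≈ y → class x ≡ class y
    rep        : Fin size → Carrier
    rep-class  : ∀ x → rep (class x) ≈ x

module _ {X : Setoid 0ℓ 0ℓ} (fin : Finite X) where
  open Finite fin
  private
    module X = Setoid X
    F = freeAbelianGroup X
    module F = AbelianGroup F
    module ℤ+ = AbelianGroup ℤ.+-0-abelianGroup
    module FP = Power F.group
  open Sum F.commutativeMonoid using (sum; sum-cong-≋; sum-remove; sum-replicate-zero; ∑-distrib-+)
  open SetoidReasoning F.setoid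

  δ : ∀ {m} → Fin m → Fin m → ℤ
  δ i j = if does (i Fin.≟ j) then 1ℤ else 0ℤ

  coefficient : Fin size → Additive F ℤ.+-0-abelianGroup
  coefficient i = extendᴬ ℤ.+-0-abelianGroup X (λ x → δ (class x) i)
    (λ e → ≡.cong (λ j → δ j i) (class-cong e))

  private module C i = Additive (coefficient i)

  sum-⊖ : ∀ {m} (t : Vector F.Carrier m) → sum (λ i → ⊖ t i) F.≈ ⊖ sum t
  sum-⊖ {zero}  t = F.sym (GroupProperties.ε⁻¹≈ε F.group)
  sum-⊖ {suc m} t = F.trans (F.∙-congˡ (sum-⊖ (t ∘ suc))) (AbelianGroupProperties.⁻¹-∙-comm F _ _)

  δ-refl : ∀ {m} (j : Fin m) → δ j j ≡ 1ℤ
  δ-refl j with j Fin.≟ j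
  ... | yes _ = ≡.refl
  ... | no ne = contradiction ≡.refl ne

  δ-punchIn : ∀ {m} (j : Fin (suc m)) k → δ j (punchIn j k) ≡ 0ℤ
  δ-punchIn j k with j Fin.≟ punchIn j k
  ... | yes e = contradiction (≡.sym e) (Fin.punchInᵢ≢i j k)
  ... | no _  = ≡.refl

  sum-δ : ∀ {m} (t : Vector F.Carrier m) j → sum (λ i → t i FP.^ δ j i) F.≈ t j
  sum-δ {suc m} t j = begin
    sum u                     ≈⟨ sum-remove {i = j} u ⟩
    u j ⊕ sum (removeAt u j)  ≈⟨ ⊕-cong
      (F.trans (FP.^-≡ (t j) (δ-refl j)) (F.identityʳ _))
      (F.trans (sum-cong-≋ {n = m} (λ k → FP.^-≡ (t (punchIn j k)) (δ-punchIn j k))) (sum-replicate-zero m)) ⟩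
    t j ⊕ 𝟘                   ≈⟨ F.identityʳ _ ⟩
    t j                       ∎
    where u = λ i → t i FP.^ δ j i

  expansion : ∀ s → s F.≈ sum (λ i → [ rep i ] FP.^ C.fun i s)
  expansion [ x ]   = F.sym (F.trans (sum-δ (λ i → [ rep i ]) (class x)) ([]-cong (rep-class x)))
  expansion 𝟘       = F.sym (sum-replicate-zero size)
  expansion (s ⊕ t) = begin
    s ⊕ t                                          ≈⟨ ⊕-cong (expansion s) (expansion t) ⟩
    sum (λ i → [ rep i ] FP.^ C.fun i s) ⊕ sum (λ i → [ rep i ] FP.^ C.fun i t)
      ≈⟨ ∑-distrib-+ {size} _ _ ⟨
    sum (λ i → [ rep i ] FP.^ C.fun i s ⊕ [ rep i ] FP.^ C.fun i t)
      ≈⟨ sum-cong-≋ {n = size} (λ i → F.sym (FP.^-homo-+ [ rep i ] (C.fun i s) (C.fun i t))) ⟩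
    sum (λ i → [ rep i ] FP.^ C.fun i (s ⊕ t))     ∎
  expansion (⊖ s)   = begin
    ⊖ s                                            ≈⟨ ⊖-cong (expansion s) ⟩
    ⊖ sum (λ i → [ rep i ] FP.^ C.fun i s)         ≈⟨ sum-⊖ {size} _ ⟨
    sum (λ i → ⊖ ([ rep i ] FP.^ C.fun i s))
      ≈⟨ sum-cong-≋ {n = size} (λ i → F.sym (FP.^-neg [ rep i ] (C.fun i s))) ⟩
    sum (λ i → [ rep i ] FP.^ C.fun i (⊖ s))       ∎

  ^ℕ≡* : ∀ k z → Power._^ℕ_ ℤ+.group z k ≡ + k ℤ.* z
  ^ℕ≡* zero    z = ≡.refl
  ^ℕ≡* (suc k) z = ≡.trans (≡.cong (λ t → z ℤ.+ t) (^ℕ≡* k z)) (≡.sym (ℤ.suc-* (+ k) z))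

  ℤ-torsion : ∀ k .{{_ : NonZero k}} z → Power._^ℕ_ ℤ+.group z k ≡ 0ℤ → z ≡ 0ℤ
  ℤ-torsion (suc k) z e with ℤ.i*j≡0⇒i≡0∨j≡0 (+ suc k) (≡.trans (≡.sym (^ℕ≡* (suc k) z)) e)
  ... | inj₂ p = p

  module _ {G : Group 0ℓ 0ℓ} (action : LinearAction G F) where
    private
      M = toModule G action
      module M = LeftModule M
      module RP = Power (AbelianGroup.group (ℤG G))
      module G = Group G
      module MM = RawMonoidDefinitions M.+ᴹ-rawMonoid
    open Linear G action

    freeLattice : Lattice G
    freeLattice = record
      { leftModule        = M
      ; finitelyGenerated = size , (λ i → [ rep i ]) , λ s →
          (λ i → [ G.ε ] RP.^ C.fun i s) , F.trans (expansion s)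
            (sum-cong-≋ {n = size} λ i → F.sym (F.trans
              (Additive.^-homo (⋆ᴬ [ rep i ]) [ G.ε ] (C.fun i s))
              (FP.^-cong (C.fun i s) (⋆-identityˡ [ rep i ]))))
      ; torsionFree       = λ k s e → F.trans (expansion s) (F.trans
          (sum-cong-≋ {n = size} λ i → FP.^-≡ [ rep i ] (ℤ-torsion k (C.fun i s)
            (≡.trans (≡.sym (C.^ℕ-homo i s k))
              (C.cong i (F.trans (F.reflexive (≡.sym (×≡^ℕ k s))) e)))))
          (sum-replicate-zero size))
      }
      where
      ×≡^ℕ : ∀ k s → k MM.× s ≡ s FP.^ℕ k
      ×≡^ℕ zero    s = ≡.refl
      ×≡^ℕ (suc k) s = ≡.cong (s ⊕_) (×≡^ℕ k s)

------------------------------------------------------------------------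
-- The trivial lattice and permutation lattices

module _ (G : Group 0ℓ 0ℓ) where
  private module G = Group G

  trivialAction : (A : AbelianGroup 0ℓ 0ℓ) → LinearAction G A
  trivialAction A = record
    { gset   = record
      { _·_ = λ _ x → x ; ·-cong = λ _ e → e ; ·-identity = λ _ → A.refl ; ·-assoc = λ _ _ _ → A.refl }
    ; ·-homo = λ _ _ _ → A.refl
    } where module A = AbelianGroup A

  record Subgroup : Set₁ where
    field
      Member : Pred G.Carrier 0ℓ
      ≈∈     : ∀ {x y} → x G.≈ y → Member x → Member y
      ε∈     : Member G.ε
      ∙∈     : ∀ {x y} → Member x → Member y → Member (x G.∙ y)
      ⁻¹∈    : ∀ {x} → Member x → Member (x G.⁻¹)

  data Generated (x : G.Carrier) : Pred G.Carrier 0ℓ where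
    generator : Generated x x
    gen-≈     : ∀ {y z} → y G.≈ z → Generated x y → Generated x z
    gen-ε     : Generated x G.ε
    gen-∙     : ∀ {y z} → Generated x y → Generated x z → Generated x (y G.∙ z)
    gen-⁻¹    : ∀ {y} → Generated x y → Generated x (y G.⁻¹)

  ⟨_⟩ : G.Carrier → Subgroup
  ⟨ x ⟩ = record
    { Member = Generated x ; ≈∈ = gen-≈ ; ε∈ = gen-ε ; ∙∈ = gen-∙ ; ⁻¹∈ = gen-⁻¹ }

  module _ (S : Subgroup) where
    open Subgroup S
    open GroupProperties G
    open SetoidReasoning G.setoid

    -- The element g stands for the left coset gS.
    Cosets : Setoid 0ℓ 0ℓ
    Cosets = record
      { Carrier       = G.Carrier
      ; _≈_           = λ g h → Member (g G.⁻¹ G.∙ h)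
      ; isEquivalence = record
        { refl  = λ {g} → ≈∈ (G.sym (G.inverseˡ g)) ε∈
        ; sym   = λ {g} {h} p → ≈∈ (⁻¹-anti-homo-\\ g h) (⁻¹∈ p)
        ; trans = λ {g} {h} {k} p q → ≈∈ (lemma g h k) (∙∈ p q)
        }
      }
      where
      lemma : ∀ g h k → (g G.⁻¹ G.∙ h) G.∙ (h G.⁻¹ G.∙ k) G.≈ g G.⁻¹ G.∙ k
      lemma g h k = G.trans (G.assoc _ _ _) (G.∙-congˡ (\\-leftDividesˡ h k))

    cosetAction : GSet G Cosets
    cosetAction = record
      { _·_        = G._∙_
      ; ·-cong     = λ {g} {h} {x} {y} p q → ≈∈ (lemma g h x y p) q
      ; ·-identity = λ x → ≈⇒~ (G.identityˡ x)
      ; ·-assoc    = λ g h x → ≈⇒~ (G.assoc g h x)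
      }
      where
      ≈⇒~ : ∀ {g h} → g G.≈ h → Member (g G.⁻¹ G.∙ h)
      ≈⇒~ {g} {h} e = ≈∈ (G.trans (G.sym (G.inverseˡ g)) (G.∙-congˡ e)) ε∈
      lemma : ∀ g h x y → g G.≈ h → x G.⁻¹ G.∙ y G.≈ (g G.∙ x) G.⁻¹ G.∙ (h G.∙ y)
      lemma g h x y p = G.sym (begin
        (g G.∙ x) G.⁻¹ G.∙ (h G.∙ y)             ≈⟨ G.∙-congʳ (⁻¹-anti-homo-∙ g x) ⟩
        (x G.⁻¹ G.∙ g G.⁻¹) G.∙ (h G.∙ y)        ≈⟨ G.assoc _ _ _ ⟩
        x G.⁻¹ G.∙ (g G.⁻¹ G.∙ (h G.∙ y))        ≈⟨ G.∙-congˡ (G.∙-congˡ (G.∙-congʳ p)) ⟨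
        x G.⁻¹ G.∙ (g G.⁻¹ G.∙ (g G.∙ y))        ≈⟨ G.∙-congˡ (\\-leftDividesʳ g y) ⟩
        x G.⁻¹ G.∙ y                             ∎)

  permutationLattice : (S : Subgroup) → Finite (Cosets S) → Lattice G
  permutationLattice S fin = freeLattice fin (linearise G (Cosets S) (cosetAction S))

  trivialLattice : Lattice G
  trivialLattice = record
    { leftModule        = M
    ; finitelyGenerated = 1 , (λ _ → 1ℤ) , λ z →
        (λ _ → Power._^_ (AbelianGroup.group (ℤG G)) [ G.ε ] z) ,
        ≡.sym (≡.trans (ℤ.+-identityʳ _)
          (≡.trans (Additive.^-homo (⋆ᴬ 1ℤ) [ G.ε ] z) (1^ z)))
    ; torsionFree       = λ where (suc k) z e → tf k z e
    }
    where
    ℤ+ = ℤ.+-0-abelianGroup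
    M = toModule G (trivialAction ℤ+)
    open Linear G (trivialAction ℤ+)
    module MM = RawMonoidDefinitions (LeftModule.+ᴹ-rawMonoid M)
    open Power (AbelianGroup.group ℤ+)

    1^ℕ : ∀ k → 1ℤ ^ℕ k ≡ + k
    1^ℕ zero    = ≡.refl
    1^ℕ (suc k) = ≡.cong (λ t → 1ℤ ℤ.+ t) (1^ℕ k)

    1^ : ∀ z → 1ℤ ^ z ≡ z
    1^ (+ k)    = 1^ℕ k
    1^ -[1+ k ] = ≡.cong ℤ.-_ (1^ℕ (suc k))

    ×≡* : ∀ k z → k MM.× z ≡ + k ℤ.* z
    ×≡* zero    z = ≡.refl
    ×≡* (suc k) z = ≡.trans (≡.cong (λ t → z ℤ.+ t) (×≡* k z)) (≡.sym (ℤ.suc-* (+ k) z))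

    tf : ∀ k z → suc k MM.× z ≡ 0ℤ → z ≡ 0ℤ
    tf k z e with ℤ.i*j≡0⇒i≡0∨j≡0 (+ suc k) (≡.trans (≡.sym (×≡* (suc k) z)) e)
    ... | inj₂ p = p

------------------------------------------------------------------------
-- Groups given by generators and relations: words modulo the least
-- congruence containing the group laws and the relators.

infixl 7 _∙ʷ_
infix  9 _⁻¹ʷ
infixl 8 _^ʷ_

data Word (I : Set) : Set where
  letter : I → Word I
  εʷ     : Word I
  _∙ʷ_   : Word I → Word I → Word I
  _⁻¹ʷ   : Word I → Word I

_^ʷ_ : {I : Set} → Word I → ℕ → Word I
x ^ʷ zero  = εʷ
x ^ʷ suc k = x ∙ʷ x ^ʷ k

module _ {I : Set} (Relator : Rel (Word I) 0ℓ) where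

  data WordEq : Rel (Word I) 0ℓ where
    relator   : ∀ {x y} → Relator x y → WordEq x y
    refl      : ∀ {x} → WordEq x x
    sym       : ∀ {x y} → WordEq x y → WordEq y x
    trans     : ∀ {x y z} → WordEq x y → WordEq y z → WordEq x z
    ∙-cong    : ∀ {x x′ y y′} → WordEq x x′ → WordEq y y′ → WordEq (x ∙ʷ y) (x′ ∙ʷ y′)
    ⁻¹-cong   : ∀ {x y} → WordEq x y → WordEq (x ⁻¹ʷ) (y ⁻¹ʷ)
    assoc     : ∀ x y z → WordEq ((x ∙ʷ y) ∙ʷ z) (x ∙ʷ (y ∙ʷ z))
    identityˡ : ∀ x → WordEq (εʷ ∙ʷ x) x
    identityʳ : ∀ x → WordEq (x ∙ʷ εʷ) x
    inverseˡ  : ∀ x → WordEq (x ⁻¹ʷ ∙ʷ x) εʷ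
    inverseʳ  : ∀ x → WordEq (x ∙ʷ x ⁻¹ʷ) εʷ

  presented : Group 0ℓ 0ℓ
  presented = record
    { Carrier = Word I
    ; _≈_     = WordEq
    ; _∙_     = _∙ʷ_
    ; ε       = εʷ
    ; _⁻¹     = _⁻¹ʷ
    ; isGroup = record
      { isMonoid = record
        { isSemigroup = record
          { isMagma = record
            { isEquivalence = record { refl = refl ; sym = sym ; trans = trans }
            ; ∙-cong = ∙-cong
            }
          ; assoc = assoc
          }
        ; identity = identityˡ , identityʳ
        }
      ; inverse = inverseˡ , inverseʳ
      ; ⁻¹-cong = ⁻¹-cong
      }
    }

module _ {I : Set} (H : Group 0ℓ 0ℓ) (f : I → Group.Carrier H) where
  private module H = Group H

  eval : Word I → H.Carrier
  eval (letter i) = f i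
  eval εʷ         = H.ε
  eval (x ∙ʷ y)   = eval x H.∙ eval y
  eval (x ⁻¹ʷ)    = (eval x) H.⁻¹

  module _ (Relator : Rel (Word I) 0ℓ)
           (holds : ∀ {x y} → Relator x y → eval x H.≈ eval y) where

    eval-cong : ∀ {x y} → WordEq Relator x y → eval x H.≈ eval y
    eval-cong (relator r)   = holds r
    eval-cong refl          = H.refl
    eval-cong (sym p)       = H.sym (eval-cong p)
    eval-cong (trans p q)   = H.trans (eval-cong p) (eval-cong q)
    eval-cong (∙-cong p q)  = H.∙-cong (eval-cong p) (eval-cong q)
    eval-cong (⁻¹-cong p)   = H.⁻¹-cong (eval-cong p)
    eval-cong (assoc x y z) = H.assoc _ _ _
    eval-cong (identityˡ x) = H.identityˡ _
    eval-cong (identityʳ x) = H.identityʳ _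
    eval-cong (inverseˡ x)  = H.inverseˡ _
    eval-cong (inverseʳ x)  = H.inverseʳ _

------------------------------------------------------------------------
-- The dihedral group

data Generator : Set where
  σ′ τ′ : Generator

σ τ : Word Generator
σ = letter σ′
τ = letter τ′

data DihedralRelator (n : ℕ) : Rel (Word Generator) 0ℓ where
  σⁿ≈1       : DihedralRelator n (σ ^ʷ n) εʷ
  τ²≈1       : DihedralRelator n (τ ^ʷ 2) εʷ
  τστ⁻¹≈σ⁻¹  : DihedralRelator n (τ ∙ʷ σ ∙ʷ τ ⁻¹ʷ) (σ ⁻¹ʷ)

D : ℕ → Group 0ℓ 0ℓ
D n = presented (DihedralRelator n)

------------------------------------------------------------------------
-- Congruence modulo n

infix 4 _≡_[mod_]

record _≡_[mod_] (i j : ℤ) (n : ℕ) : Set where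
  constructor congruent
  field n∣i-j : + n ∣ i ℤ.- j

module _ {n : ℕ} where

  mod-reflexive : ∀ {i j} → i ≡ j → i ≡ j [mod n ]
  mod-reflexive {i} ≡.refl = congruent (divides 0ℤ (ℤ.+-inverseʳ i))

  mod-resp : ∀ {i j i′ j′} → i ℤ.- j ≡ i′ ℤ.- j′ → i ≡ j [mod n ] → i′ ≡ j′ [mod n ]
  mod-resp e (congruent (divides q p)) = congruent (divides q (≡.trans (≡.sym e) p))

  mod-sym : ∀ {i j} → i ≡ j [mod n ] → j ≡ i [mod n ]
  mod-sym {i} {j} (congruent (divides q p)) = congruent (divides (ℤ.- q)
    (≡.trans (e₁ i j) (≡.trans (≡.cong ℤ.-_ p) (ℤ.neg-distribˡ-* q (+ n)))))
    where
    e₁ : ∀ i j → j ℤ.- i ≡ ℤ.- (i ℤ.- j)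
    e₁ = solve-∀

  mod-+ : ∀ {i j i′ j′} → i ≡ j [mod n ] → i′ ≡ j′ [mod n ] → i ℤ.+ i′ ≡ j ℤ.+ j′ [mod n ]
  mod-+ {i} {j} {i′} {j′} (congruent (divides q p)) (congruent (divides q′ p′)) = congruent (divides (q ℤ.+ q′)
    (≡.trans (e₁ i j i′ j′) (≡.trans (≡.cong₂ ℤ._+_ p p′) (≡.sym (ℤ.*-distribʳ-+ (+ n) q q′)))))
    where
    e₁ : ∀ i j i′ j′ → i ℤ.+ i′ ℤ.- (j ℤ.+ j′) ≡ (i ℤ.- j) ℤ.+ (i′ ℤ.- j′)
    e₁ = solve-∀

  mod-trans : ∀ {i j k} → i ≡ j [mod n ] → j ≡ k [mod n ] → i ≡ k [mod n ]
  mod-trans {i} {j} {k} p q = mod-resp (e₁ i j k) (mod-+ p q)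
    where
    e₁ : ∀ i j k → i ℤ.+ j ℤ.- (j ℤ.+ k) ≡ i ℤ.- k
    e₁ = solve-∀

  mod-neg : ∀ {i j} → i ≡ j [mod n ] → ℤ.- i ≡ ℤ.- j [mod n ]
  mod-neg {i} {j} p = mod-resp (e₁ i j) (mod-sym p)
    where
    e₁ : ∀ i j → j ℤ.- i ≡ ℤ.- i ℤ.- ℤ.- j
    e₁ = solve-∀

  mod-n : ∀ i → i ℤ.+ + n ≡ i [mod n ]
  mod-n i = congruent (divides 1ℤ (≡.trans (e₁ i (+ n)) (≡.sym (ℤ.*-identityˡ (+ n)))))
    where
    e₁ : ∀ i m → i ℤ.+ m ℤ.- i ≡ m
    e₁ = solve-∀

  module _ .{{_ : NonZero n}} where

    mod-% : ∀ i → + (i ℤ.%ℕ n) ≡ i [mod n ]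
    mod-% i = congruent (divides (ℤ.- (i ℤ./ℕ n)) (≡.trans
      (≡.cong (λ t → + (i ℤ.%ℕ n) ℤ.- t) (ℤ.a≡a%ℕn+[a/ℕn]*n i n))
      (e₁ (+ (i ℤ.%ℕ n)) (i ℤ./ℕ n) (+ n))))
      where
      e₁ : ∀ r q m → r ℤ.- (r ℤ.+ q ℤ.* m) ≡ ℤ.- q ℤ.* m
      e₁ = solve-∀

    mod-unique : ∀ {r s} → r ℕ.< n → s ℕ.< n → + r ≡ + s [mod n ] → r ≡ s
    mod-unique {r} {s} r<n s<n (congruent p) =
      ℤ.+-injective (ℤ.i-j≡0⇒i≡j (+ r) (+ s) (ℤ.∣i∣≡0⇒i≡0 (zero-of (ℤ.∣⇒∣ᵤ p) small)))
      where
      small : ℤ.∣ + r ℤ.- + s ∣ ℕ.< n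
      small = ℕ.≤-<-trans
        (≡.subst (ℕ._≤ r ℕ.⊔ s) (≡.cong ℤ.∣_∣ (≡.sym (ℤ.[+m]-[+n]≡m⊖n r s))) (ℤ.∣m⊝n∣≤m⊔n r s))
        (ℕ.⊔-lub r<n s<n)
      zero-of : ∀ {d} → n ℕ.∣ d → d ℕ.< n → d ≡ 0
      zero-of {zero}  _ _   = ≡.refl
      zero-of {suc d} p d<n = contradiction p (ℕ.>⇒∤ d<n)

    residue : ℤ → Fin n
    residue i = fromℕ< (ℤ.n%ℕd<d i n)

    residue-cong : ∀ {i j} → i ≡ j [mod n ] → residue i ≡ residue j
    residue-cong {i} {j} p = Fin.fromℕ<-cong _ _
      (mod-unique (ℤ.n%ℕd<d i n) (ℤ.n%ℕd<d j n)
        (mod-trans (mod-% i) (mod-trans p (mod-sym (mod-% j)))))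
      (ℤ.n%ℕd<d i n) (ℤ.n%ℕd<d j n)

    residue-≡ : ∀ i → + toℕ (residue i) ≡ i [mod n ]
    residue-≡ i = mod-trans (mod-reflexive (≡.cong +_ (Fin.toℕ-fromℕ< (ℤ.n%ℕd<d i n)))) (mod-% i)

------------------------------------------------------------------------
-- Normal forms in the dihedral group, and finiteness of its cosets

module Affine (n : ℕ) where

  act : Sign → ℤ → ℤ
  act Sign.+ a = a
  act Sign.- a = ℤ.- a

  act-mod : ∀ s {a b} → a ≡ b [mod n ] → act s a ≡ act s b [mod n ]
  act-mod Sign.+ p = p
  act-mod Sign.- p = mod-neg p

  act-0 : ∀ s → act s 0ℤ ≡ 0ℤ
  act-0 Sign.+ = ≡.refl
  act-0 Sign.- = ≡.refl

  infix 4 _≈ᴬ_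
  _≈ᴬ_ : Rel (Sign × ℤ) 0ℓ
  (s , a) ≈ᴬ (t , b) = (s ≡ t) × (a ≡ b [mod n ])

  infixl 7 _∙ᴬ_
  _∙ᴬ_ : Op₂ (Sign × ℤ)
  (s , a) ∙ᴬ (t , b) = s Sign.* t , a ℤ.+ act s b

  _⁻¹ᴬ : Sign × ℤ → Sign × ℤ
  (s , a) ⁻¹ᴬ = s , ℤ.- act s a

  ∙-congᴬ : ∀ x y u v → x ≈ᴬ y → u ≈ᴬ v → x ∙ᴬ u ≈ᴬ y ∙ᴬ v
  ∙-congᴬ (s , _) _ _ _ (≡.refl , p) (≡.refl , q) = ≡.refl , mod-+ p (act-mod s q)

  ⁻¹-congᴬ : ∀ x y → x ≈ᴬ y → x ⁻¹ᴬ ≈ᴬ y ⁻¹ᴬ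
  ⁻¹-congᴬ (s , _) _ (≡.refl , p) = ≡.refl , mod-neg (act-mod s p)

  -- The affine maps x ↦ s x + a of ℤ/n, with s = ±1.
  affine : Group 0ℓ 0ℓ
  affine = record
    { Carrier = Sign × ℤ
    ; _≈_     = _≈ᴬ_
    ; _∙_     = _∙ᴬ_
    ; ε       = Sign.+ , 0ℤ
    ; _⁻¹     = _⁻¹ᴬ
    ; isGroup = record
      { isMonoid = record
        { isSemigroup = record
          { isMagma = record
            { isEquivalence = record
              { refl  = ≡.refl , mod-reflexive ≡.refl
              ; sym   = λ (e , p) → ≡.sym e , mod-sym p
              ; trans = λ (e , p) (f , q) → ≡.trans e f , mod-trans p q
              }
            ; ∙-cong = λ {x} {y} {u} {v} → ∙-congᴬ x y u v
            }
          ; assoc = λ where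
              (Sign.+ , a) (Sign.+ , b) (u , c) → ≡.refl , mod-reflexive (ℤ.+-assoc a b _)
              (Sign.+ , a) (Sign.- , b) (u , c) → ≡.refl , mod-reflexive (ℤ.+-assoc a b _)
              (Sign.- , a) (Sign.+ , b) (u , c) → ≡.refl , mod-reflexive (e₁ a b c)
              (Sign.- , a) (Sign.- , b) (Sign.+ , c) → ≡.refl , mod-reflexive (e₂ a b c)
              (Sign.- , a) (Sign.- , b) (Sign.- , c) → ≡.refl , mod-reflexive (e₂ a b c)
          }
        ; identity = (λ (s , a) → ≡.refl , mod-reflexive (ℤ.+-identityˡ a)) ,
                     λ (s , a) → Sign.*-identityʳ s , mod-reflexive
                       (≡.trans (≡.cong (λ t → a ℤ.+ t) (act-0 s)) (ℤ.+-identityʳ a))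
        }
      ; inverse = (λ where
            (Sign.+ , a) → ≡.refl , mod-reflexive (ℤ.+-inverseˡ a)
            (Sign.- , a) → ≡.refl , mod-reflexive (ℤ.+-inverseˡ (ℤ.- a))) ,
          (λ where
            (Sign.+ , a) → ≡.refl , mod-reflexive (ℤ.+-inverseʳ a)
            (Sign.- , a) → ≡.refl , mod-reflexive (e₃ a))
      ; ⁻¹-cong = λ {x} {y} → ⁻¹-congᴬ x y
      }
    }
    where
    e₁ : ∀ a b c → a ℤ.+ ℤ.- b ℤ.+ ℤ.- c ≡ a ℤ.+ ℤ.- (b ℤ.+ c)
    e₁ = solve-∀
    e₂ : ∀ a b c → a ℤ.+ ℤ.- b ℤ.+ c ≡ a ℤ.+ ℤ.- (b ℤ.+ ℤ.- c)
    e₂ = solve-∀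
    e₃ : ∀ a → a ℤ.+ ℤ.- (ℤ.- ℤ.- a) ≡ 0ℤ
    e₃ = solve-∀

  private
    module A = Group affine
    module D = Group (D n)
  open Power (D n)
  open GroupProperties (D n)
  open SetoidReasoning D.setoid

  φ-letter : Generator → A.Carrier
  φ-letter σ′ = Sign.+ , 1ℤ
  φ-letter τ′ = Sign.- , 0ℤ

  φ : D.Carrier → A.Carrier
  φ = eval affine φ-letter

  φ-σ^ : ∀ k → φ (σ ^ʷ k) ≡ (Sign.+ , + k)
  φ-σ^ zero    = ≡.refl
  φ-σ^ (suc k) = ≡.cong (λ x → φ σ A.∙ x) (φ-σ^ k)

  φ-cong : ∀ {g h} → g D.≈ h → φ g A.≈ φ h
  φ-cong = eval-cong affine φ-letter (DihedralRelator n) λ where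
    σⁿ≈1      → A.trans (A.reflexive (φ-σ^ n)) (≡.refl , mod-n 0ℤ)
    τ²≈1      → A.refl
    τστ⁻¹≈σ⁻¹ → A.refl

  τ^ : Sign → D.Carrier
  τ^ Sign.+ = D.ε
  τ^ Sign.- = τ

  nf : A.Carrier → D.Carrier
  nf (s , a) = σ ^ a D.∙ τ^ s

  ^ʷ≡^ℕ : ∀ x k → x ^ʷ k ≡ x ^ℕ k
  ^ʷ≡^ℕ x zero    = ≡.refl
  ^ʷ≡^ℕ x (suc k) = ≡.cong (x ∙ʷ_) (^ʷ≡^ℕ x k)

  ττ : τ D.∙ τ D.≈ D.ε
  ττ = D.trans (D.∙-congˡ (D.sym (D.identityʳ τ))) (relator τ²≈1)

  τσ : τ D.∙ σ D.≈ σ D.⁻¹ D.∙ τ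
  τσ = begin
    τ D.∙ σ                          ≈⟨ //-rightDividesˡ τ (τ D.∙ σ) ⟨
    τ D.∙ σ D.∙ τ D.⁻¹ D.∙ τ         ≈⟨ D.∙-congʳ (relator τστ⁻¹≈σ⁻¹) ⟩
    σ D.⁻¹ D.∙ τ                     ∎

  τσ^ℕ : ∀ k → τ D.∙ σ ^ℕ k D.≈ (σ ^ℕ k) D.⁻¹ D.∙ τ
  τσ^ℕ zero    = D.trans (D.identityʳ τ) (D.sym (D.trans (D.∙-congʳ ε⁻¹≈ε) (D.identityˡ τ)))
  τσ^ℕ (suc k) = begin
    τ D.∙ (σ D.∙ σ ^ℕ k)                    ≈⟨ D.assoc _ _ _ ⟨
    τ D.∙ σ D.∙ σ ^ℕ k                      ≈⟨ D.∙-congʳ τσ ⟩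
    σ D.⁻¹ D.∙ τ D.∙ σ ^ℕ k                 ≈⟨ D.assoc _ _ _ ⟩
    σ D.⁻¹ D.∙ (τ D.∙ σ ^ℕ k)               ≈⟨ D.∙-congˡ (τσ^ℕ k) ⟩
    σ D.⁻¹ D.∙ ((σ ^ℕ k) D.⁻¹ D.∙ τ)        ≈⟨ D.assoc _ _ _ ⟨
    σ D.⁻¹ D.∙ (σ ^ℕ k) D.⁻¹ D.∙ τ          ≈⟨ D.∙-congʳ (⁻¹-anti-homo-∙ _ _) ⟨
    (σ ^ℕ k D.∙ σ) D.⁻¹ D.∙ τ               ≈⟨ D.∙-congʳ (D.⁻¹-cong (^ℕ-comm σ k)) ⟨
    (σ D.∙ σ ^ℕ k) D.⁻¹ D.∙ τ               ∎

  τσ^ : ∀ b → τ D.∙ σ ^ b D.≈ σ ^ (ℤ.- b) D.∙ τ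
  τσ^ (+ k)    = D.trans (τσ^ℕ k) (D.∙-congʳ (D.sym (^-neg σ (+ k))))
  τσ^ -[1+ k ] = begin
    τ D.∙ x D.⁻¹                          ≈⟨ \\-leftDividesˡ x (τ D.∙ x D.⁻¹) ⟨
    x D.∙ (x D.⁻¹ D.∙ (τ D.∙ x D.⁻¹))     ≈⟨ D.∙-congˡ (D.assoc _ _ _) ⟨
    x D.∙ (x D.⁻¹ D.∙ τ D.∙ x D.⁻¹)       ≈⟨ D.∙-congˡ (D.∙-congʳ (τσ^ℕ (suc k))) ⟨
    x D.∙ (τ D.∙ x D.∙ x D.⁻¹)            ≈⟨ D.∙-congˡ (//-rightDividesʳ x τ) ⟩
    x D.∙ τ                               ∎
    where x = σ ^ℕ suc k

  τ^-σ^ : ∀ s b → τ^ s D.∙ σ ^ b D.≈ σ ^ act s b D.∙ τ^ s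
  τ^-σ^ Sign.+ b = D.trans (D.identityˡ _) (D.sym (D.identityʳ _))
  τ^-σ^ Sign.- b = τσ^ b

  τ^-* : ∀ s t → τ^ (s Sign.* t) D.≈ τ^ s D.∙ τ^ t
  τ^-* Sign.+ t      = D.sym (D.identityˡ _)
  τ^-* Sign.- Sign.+ = D.sym (D.identityʳ _)
  τ^-* Sign.- Sign.- = D.sym ττ

  nf-homo : ∀ x y → nf (x A.∙ y) D.≈ nf x D.∙ nf y
  nf-homo (s , a) (t , b) = begin
    σ ^ (a ℤ.+ act s b) D.∙ τ^ (s Sign.* t)           ≈⟨ D.∙-cong (^-homo-+ σ a (act s b)) (τ^-* s t) ⟩
    (σ ^ a D.∙ σ ^ act s b) D.∙ (τ^ s D.∙ τ^ t)       ≈⟨ D.assoc _ _ _ ⟩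
    σ ^ a D.∙ (σ ^ act s b D.∙ (τ^ s D.∙ τ^ t))       ≈⟨ D.∙-congˡ (D.assoc _ _ _) ⟨
    σ ^ a D.∙ (σ ^ act s b D.∙ τ^ s D.∙ τ^ t)         ≈⟨ D.∙-congˡ (D.∙-congʳ (τ^-σ^ s b)) ⟨
    σ ^ a D.∙ (τ^ s D.∙ σ ^ b D.∙ τ^ t)               ≈⟨ D.∙-congˡ (D.assoc _ _ _) ⟩
    σ ^ a D.∙ (τ^ s D.∙ (σ ^ b D.∙ τ^ t))             ≈⟨ D.assoc _ _ _ ⟨
    (σ ^ a D.∙ τ^ s) D.∙ (σ ^ b D.∙ τ^ t)             ∎

  σ^-mod : ∀ {a b} → a ≡ b [mod n ] → σ ^ a D.≈ σ ^ b
  σ^-mod {a} {b} (congruent (divides q p)) = begin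
    σ ^ a                        ≈⟨ ^-≡ σ (e₁ a b) ⟩
    σ ^ (a ℤ.- b ℤ.+ b)          ≈⟨ ^-homo-+ σ (a ℤ.- b) b ⟩
    σ ^ (a ℤ.- b) D.∙ σ ^ b      ≈⟨ D.∙-congʳ (^-≡ σ p) ⟩
    σ ^ (q ℤ.* + n) D.∙ σ ^ b    ≈⟨ D.∙-congʳ (^-zero-* σ n
                                      (D.trans (D.reflexive (≡.sym (^ʷ≡^ℕ σ n))) (relator σⁿ≈1)) q) ⟩
    D.ε D.∙ σ ^ b                ≈⟨ D.identityˡ _ ⟩
    σ ^ b                        ∎
    where
    e₁ : ∀ a b → a ≡ a ℤ.- b ℤ.+ b
    e₁ = solve-∀

  nf-cong : ∀ {x y} → x A.≈ y → nf x D.≈ nf y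
  nf-cong (≡.refl , p) = D.∙-congʳ (σ^-mod p)

  nf-φ : ∀ g → g D.≈ nf (φ g)
  nf-φ (letter σ′) = D.sym (D.trans (D.identityʳ _) (D.identityʳ _))
  nf-φ (letter τ′) = D.sym (D.identityˡ _)
  nf-φ εʷ          = D.sym (D.identityˡ _)
  nf-φ (g ∙ʷ h)    = D.trans (D.∙-cong (nf-φ g) (nf-φ h)) (D.sym (nf-homo (φ g) (φ h)))
  nf-φ (g ⁻¹ʷ)     = D.trans (D.⁻¹-cong (nf-φ g)) (D.sym (inverseˡ-unique _ _ (begin
    nf (φ g A.⁻¹) D.∙ nf (φ g)   ≈⟨ nf-homo (φ g A.⁻¹) (φ g) ⟨
    nf (φ g A.⁻¹ A.∙ φ g)        ≈⟨ nf-cong (A.inverseˡ (φ g)) ⟩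
    nf A.ε                       ≈⟨ D.identityˡ _ ⟩
    D.ε                          ∎)))

  φ-recover : ∀ g h → φ h A.≈ φ g A.∙ φ (g D.⁻¹ D.∙ h)
  φ-recover g h = φ-cong (D.sym (\\-leftDividesˡ g h))

  sign-⟨σ⟩ : ∀ {g} → Generated (D n) σ g → proj₁ (φ g) ≡ Sign.+
  sign-⟨σ⟩ generator   = ≡.refl
  sign-⟨σ⟩ (gen-≈ e p) = ≡.trans (≡.sym (proj₁ (φ-cong e))) (sign-⟨σ⟩ p)
  sign-⟨σ⟩ gen-ε       = ≡.refl
  sign-⟨σ⟩ (gen-∙ p q) = ≡.cong₂ Sign._*_ (sign-⟨σ⟩ p) (sign-⟨σ⟩ q)
  sign-⟨σ⟩ (gen-⁻¹ p)  = sign-⟨σ⟩ p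

  shift-⟨τ⟩ : ∀ {g} → Generated (D n) τ g → proj₂ (φ g) ≡ 0ℤ [mod n ]
  shift-⟨τ⟩ generator   = mod-reflexive ≡.refl
  shift-⟨τ⟩ (gen-≈ e p) = mod-trans (mod-sym (proj₂ (φ-cong e))) (shift-⟨τ⟩ p)
  shift-⟨τ⟩ gen-ε       = mod-reflexive ≡.refl
  shift-⟨τ⟩ (gen-∙ {g} p q) = mod-+ (shift-⟨τ⟩ p)
    (mod-trans (act-mod (proj₁ (φ g)) (shift-⟨τ⟩ q)) (mod-reflexive (act-0 (proj₁ (φ g)))))
  shift-⟨τ⟩ (gen-⁻¹ {g} p)  = mod-neg
    (mod-trans (act-mod (proj₁ (φ g)) (shift-⟨τ⟩ p)) (mod-reflexive (act-0 (proj₁ (φ g)))))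

  σ^ℕ∈ : ∀ k → Generated (D n) σ (σ ^ℕ k)
  σ^ℕ∈ zero    = gen-ε
  σ^ℕ∈ (suc k) = gen-∙ generator (σ^ℕ∈ k)

  σ^∈ : ∀ a → Generated (D n) σ (σ ^ a)
  σ^∈ (+ k)    = σ^ℕ∈ k
  σ^∈ -[1+ k ] = gen-⁻¹ (σ^ℕ∈ (suc k))

  τ^∈ : ∀ s → Generated (D n) τ (τ^ s)
  τ^∈ Sign.+ = gen-ε
  τ^∈ Sign.- = generator

  finite-σ : Finite (Cosets (D n) (⟨_⟩ (D n) σ))
  finite-σ = record
    { size       = 2
    ; class      = index ∘ proj₁ ∘ φ
    ; class-cong = λ {g} {h} p → ≡.cong index (≡.sym (≡.trans
        (proj₁ (φ-recover g h))
        (≡.trans (≡.cong (proj₁ (φ g) Sign.*_) (sign-⟨σ⟩ p)) (Sign.*-identityʳ (proj₁ (φ g))))))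
    ; rep        = rep
    ; rep-class  = λ g → rep-class g (φ g) (nf-φ g)
    }
    where
    index : Sign → Fin 2
    index Sign.+ = zero
    index Sign.- = suc zero
    rep : Fin 2 → D.Carrier
    rep zero    = D.ε
    rep (suc _) = τ
    rep-class : ∀ g x → g D.≈ nf x → Generated (D n) σ (rep (index (proj₁ x)) D.⁻¹ D.∙ g)
    rep-class g (Sign.+ , a) e = gen-≈ (D.sym (D.trans (D.∙-cong ε⁻¹≈ε e)
      (D.trans (D.identityˡ _) (D.identityʳ _)))) (σ^∈ a)
    rep-class g (Sign.- , a) e = gen-≈ (D.sym (begin
      τ D.⁻¹ D.∙ g                     ≈⟨ D.∙-congˡ e ⟩
      τ D.⁻¹ D.∙ (σ ^ a D.∙ τ)         ≈⟨ D.∙-congˡ (D.∙-congʳ (^-≡ σ (≡.sym (ℤ.neg-involutive a)))) ⟩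
      τ D.⁻¹ D.∙ (σ ^ (ℤ.- ℤ.- a) D.∙ τ) ≈⟨ D.∙-congˡ (τσ^ (ℤ.- a)) ⟨
      τ D.⁻¹ D.∙ (τ D.∙ σ ^ (ℤ.- a))   ≈⟨ \\-leftDividesʳ τ _ ⟩
      σ ^ (ℤ.- a)                      ∎)) (σ^∈ (ℤ.- a))

  finite-τ : .{{_ : NonZero n}} → Finite (Cosets (D n) (⟨_⟩ (D n) τ))
  finite-τ = record
    { size       = n
    ; class      = residue ∘ proj₂ ∘ φ
    ; class-cong = λ {g} {h} p → residue-cong (mod-sym (mod-trans
        (proj₂ (φ-recover g h)) (mod-trans
          (mod-+ (mod-reflexive {i = proj₂ (φ g)} ≡.refl) (mod-trans (act-mod (proj₁ (φ g)) (shift-⟨τ⟩ p))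
            (mod-reflexive (act-0 (proj₁ (φ g))))))
          (mod-reflexive (ℤ.+-identityʳ (proj₂ (φ g)))))))
    ; rep        = λ i → σ ^ (+ toℕ i)
    ; rep-class  = λ g → let s , a = φ g in gen-≈ (D.sym (begin
        (σ ^ (+ toℕ (residue a))) D.⁻¹ D.∙ g    ≈⟨ D.∙-cong (D.⁻¹-cong (σ^-mod (residue-≡ a))) (nf-φ g) ⟩
        (σ ^ a) D.⁻¹ D.∙ (σ ^ a D.∙ τ^ s)       ≈⟨ \\-leftDividesʳ (σ ^ a) (τ^ s) ⟩
        τ^ s                                    ∎)) (τ^∈ s)
    }

------------------------------------------------------------------------
-- The lattice M̃₊

-- w[ i ] is wᵢ; the indices are integers, identified modulo n by BasisEq.
data Basis : Set where
  w[_] : ℤ → Basis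
  w    : Basis

data BasisEq (n : ℕ) : Rel Basis 0ℓ where
  w[]-cong : ∀ {i j} → i ≡ j [mod n ] → BasisEq n w[ i ] w[ j ]
  w-refl   : BasisEq n w w

basis : ℕ → Setoid 0ℓ 0ℓ
basis n = record
  { Carrier       = Basis
  ; _≈_           = BasisEq n
  ; isEquivalence = record
    { refl  = λ {x} → reflᴮ x
    ; sym   = λ where (w[]-cong p) → w[]-cong (mod-sym p) ; w-refl → w-refl
    ; trans = λ where (w[]-cong p) (w[]-cong q) → w[]-cong (mod-trans p q) ; w-refl w-refl → w-refl
    }
  }
  where
  reflᴮ : ∀ x → BasisEq n x x
  reflᴮ w[ i ] = w[]-cong (mod-reflexive ≡.refl)
  reflᴮ w      = w-refl

module M̃₊-Construction (n : ℕ) where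

  F : AbelianGroup 0ℓ 0ℓ
  F = freeAbelianGroup (basis n)

  private module F = AbelianGroup F
  open Sum F.commutativeMonoid using (sum; sum-cong-≋; sum-init-last; sum-permute)
  open SetoidReasoning F.setoid
  open AbelianGroupProperties F using (⁻¹-∙-comm)
  open GroupProperties F.group using (⁻¹-involutive)

  Σw : F.Carrier
  Σw = sum {n} (λ i → [ w[ + toℕ i ] ])

  -- The images of the basis under σ, σ⁻¹ and τ = τ⁻¹.
  σ-basis σ⁻¹-basis τ-basis : Basis → F.Carrier
  σ-basis w[ i ]   = [ w[ i ℤ.+ 1ℤ ] ]
  σ-basis w        = [ w ]
  σ⁻¹-basis w[ i ] = [ w[ i ℤ.- 1ℤ ] ]
  σ⁻¹-basis w      = [ w ]
  τ-basis w[ i ]   = [ w[ ℤ.- i ] ]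
  τ-basis w        = ⊖ [ w ] ⊕ Σw

  w-cong : ∀ {i j} → i ≡ j [mod n ] → [ w[ i ] ] F.≈ [ w[ j ] ]
  w-cong p = []-cong (w[]-cong p)

  w-≡ : ∀ {i j} → i ≡ j → [ w[ i ] ] F.≈ [ w[ j ] ]
  w-≡ e = w-cong (mod-reflexive e)

  σᴬ σ⁻¹ᴬ τᴬ : Additive F F
  σᴬ   = extendᴬ F (basis n) σ-basis λ where
    (w[]-cong p) → w-cong (mod-+ p (mod-reflexive ≡.refl))
    w-refl       → refl
  σ⁻¹ᴬ = extendᴬ F (basis n) σ⁻¹-basis λ where
    (w[]-cong p) → w-cong (mod-+ p (mod-reflexive ≡.refl))
    w-refl       → refl
  τᴬ   = extendᴬ F (basis n) τ-basis λ where
    (w[]-cong p) → w-cong (mod-neg p)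
    w-refl       → refl

  private
    module σᴬ   = Additive σᴬ
    module σ⁻¹ᴬ = Additive σ⁻¹ᴬ
    module τᴬ   = Additive τᴬ

  map-sum : ∀ (f : Additive F F) {m} (t : Vector F.Carrier m) →
            Additive.fun f (sum t) F.≈ sum (Additive.fun f ∘ t)
  map-sum f {zero}  t = Additive.ε-homo f
  map-sum f {suc m} t = F.trans (Additive.homo f _ _) (F.∙-congˡ (map-sum f (t ∘ suc)))

  shift : ∀ m (u : ℕ → F.Carrier) → u m F.≈ u 0 →
          sum {m} (λ i → u (suc (toℕ i))) F.≈ sum {m} (λ i → u (toℕ i))
  shift zero    u e = refl
  shift (suc m) u e = begin
    sum {suc m} (λ i → u (suc (toℕ i)))
      ≈⟨ sum-init-last {m} (λ i → u (suc (toℕ i))) ⟩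
    sum {m} (λ i → u (suc (toℕ (inject₁ i)))) ⊕ u (suc (toℕ (Fin.fromℕ m)))
      ≈⟨ ⊕-cong (sum-cong-≋ {m} (λ i → F.reflexive (≡.cong (u ∘ suc) (Fin.toℕ-inject₁ i))))
                (F.trans (F.reflexive (≡.cong (u ∘ suc) (Fin.toℕ-fromℕ m))) e) ⟩
    sum {m} (λ i → u (suc (toℕ i))) ⊕ u 0
      ≈⟨ comm _ _ ⟩
    sum {suc m} (λ i → u (toℕ i)) ∎

  σ-Σw : σᴬ.fun Σw F.≈ Σw
  σ-Σw = begin
    σᴬ.fun Σw                            ≈⟨ map-sum σᴬ {n} _ ⟩
    sum {n} (λ i → [ w[ + toℕ i ℤ.+ 1ℤ ] ])
      ≈⟨ sum-cong-≋ {n} (λ i → w-≡ (ℤ.+-comm (+ toℕ i) 1ℤ)) ⟩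
    sum {n} (λ i → [ w[ + suc (toℕ i) ] ])
      ≈⟨ shift n (λ k → [ w[ + k ] ]) (w-cong (mod-n 0ℤ)) ⟩
    Σw                                   ∎

  τ-Σw : τᴬ.fun Σw F.≈ Σw
  τ-Σw = begin
    τᴬ.fun Σw                            ≈⟨ map-sum τᴬ {n} _ ⟩
    sum {n} (λ i → [ w[ ℤ.- (+ toℕ i) ] ])
      ≈⟨ shift n (λ k → [ w[ ℤ.- (+ k) ] ]) (w-cong (mod-neg (mod-n 0ℤ))) ⟨
    sum {n} (λ i → [ w[ ℤ.- (+ suc (toℕ i)) ] ])
      ≈⟨ sum-cong-≋ {n} (λ i → w-cong (mod-opposite i)) ⟩
    sum {n} (λ i → [ w[ + toℕ (opposite i) ] ])
      ≈⟨ sum-permute {n} (λ i → [ w[ + toℕ i ] ]) Perm.reverse ⟨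
    Σw                                   ∎
    where
    mod-opposite : ∀ i → ℤ.- (+ suc (toℕ i)) ≡ + toℕ (opposite i) [mod n ]
    mod-opposite i = mod-sym (mod-trans (mod-reflexive e) (mod-n (ℤ.- (+ suc (toℕ i)))))
      where
      e : + toℕ (opposite i) ≡ ℤ.- (+ suc (toℕ i)) ℤ.+ + n
      e = ≡.trans (≡.cong +_ (Fin.opposite-prop i))
            (≡.trans (≡.sym (ℤ.⊖-≥ (Fin.toℕ<n i)))
            (≡.trans (≡.sym (ℤ.[+m]-[+n]≡m⊖n n (suc (toℕ i)))) (ℤ.+-comm (+ n) (ℤ.- (+ suc (toℕ i))))))

  ext : (f g : Additive F F) → (∀ x → Additive.fun f [ x ] F.≈ Additive.fun g [ x ]) →
        ∀ x → Additive.fun f x F.≈ Additive.fun g x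
  ext = additive-ext F (basis n)

  cancel : ∀ x y → ⊖ (⊖ x ⊕ y) ⊕ y F.≈ x
  cancel x y = begin
    ⊖ (⊖ x ⊕ y) ⊕ y      ≈⟨ ⊕-cong (⁻¹-∙-comm (⊖ x) y) refl ⟨
    ⊖ ⊖ x ⊕ ⊖ y ⊕ y      ≈⟨ assoc _ _ _ ⟩
    ⊖ ⊖ x ⊕ (⊖ y ⊕ y)    ≈⟨ ⊕-cong (⁻¹-involutive x) (inverseˡ y) ⟩
    x ⊕ 𝟘                ≈⟨ F.identityʳ x ⟩
    x                    ∎

  τ² : ∀ x → τᴬ.fun (τᴬ.fun x) F.≈ x
  τ² = ext (τᴬ ∘ᴬ τᴬ) idᴬ λ where
    w[ i ] → w-≡ (ℤ.neg-involutive i)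
    w      → F.trans (⊕-cong refl τ-Σw) (cancel [ w ] Σw)

  act : Generator → Automorphism F
  act σ′ = record
    { to      = σᴬ
    ; from    = σ⁻¹ᴬ
    ; to∘from = ext (σᴬ ∘ᴬ σ⁻¹ᴬ) idᴬ λ where
        w[ i ] → w-≡ (e₁ i)
        w      → refl
    ; from∘to = ext (σ⁻¹ᴬ ∘ᴬ σᴬ) idᴬ λ where
        w[ i ] → w-≡ (e₂ i)
        w      → refl
    }
    where
    e₁ : ∀ i → i ℤ.- 1ℤ ℤ.+ 1ℤ ≡ i
    e₁ = solve-∀
    e₂ : ∀ i → i ℤ.+ 1ℤ ℤ.- 1ℤ ≡ i
    e₂ = solve-∀
  act τ′ = record { to = τᴬ ; from = τᴬ ; to∘from = τ² ; from∘to = τ² }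

  -- ρ respects the relators (holds below), so it defines an action of D n.
  ρ : Word Generator → Automorphism F
  ρ = eval (Aut F) act

  private module ρ g = Automorphism (ρ g)

  ρ-σ^-wᵢ : ∀ k i → ρ.fun (σ ^ʷ k) [ w[ i ] ] F.≈ [ w[ i ℤ.+ + k ] ]
  ρ-σ^-wᵢ zero    i = w-≡ (≡.sym (ℤ.+-identityʳ i))
  ρ-σ^-wᵢ (suc k) i = F.trans (σᴬ.cong (ρ-σ^-wᵢ k i))
    (w-≡ (≡.trans (ℤ.+-assoc i (+ k) 1ℤ) (≡.cong (λ t → i ℤ.+ t) (ℤ.+-comm (+ k) 1ℤ))))

  ρ-σ^-w : ∀ k → ρ.fun (σ ^ʷ k) [ w ] F.≈ [ w ]
  ρ-σ^-w zero    = refl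
  ρ-σ^-w (suc k) = σᴬ.cong (ρ-σ^-w k)

  holds : ∀ {g h} → DihedralRelator n g h → ∀ x → ρ.fun g x F.≈ ρ.fun h x
  holds σⁿ≈1 = ext (ρ.to (σ ^ʷ n)) idᴬ λ where
    w[ i ] → F.trans (ρ-σ^-wᵢ n i) (w-cong (mod-n i))
    w      → ρ-σ^-w n
  holds τ²≈1 = τ²
  holds τστ⁻¹≈σ⁻¹ = ext (τᴬ ∘ᴬ (σᴬ ∘ᴬ τᴬ)) σ⁻¹ᴬ λ where
      w[ i ] → w-≡ (e₁ i)
      w      → F.trans (⊕-cong refl (F.trans (τᴬ.cong σ-Σw) τ-Σw)) (cancel [ w ] Σw)
    where
    e₁ : ∀ i → ℤ.- (ℤ.- i ℤ.+ 1ℤ) ≡ i ℤ.- 1ℤ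
    e₁ = solve-∀

  action : LinearAction (D n) F
  action = record
    { gset   = record
      { _·_        = ρ.fun
      ; ·-cong     = λ {g} {h} {x} p q → F.trans (ρ.cong g q)
                       (eval-cong (Aut F) act (DihedralRelator n) holds p _)
      ; ·-identity = λ _ → refl
      ; ·-assoc    = λ _ _ _ → refl
      }
    ; ·-homo = ρ.homo
    }

  finite : .{{_ : NonZero n}} → Finite (basis n)
  finite = record
    { size       = suc n
    ; class      = λ where w[ i ] → suc (residue i) ; w → zero
    ; class-cong = λ where (w[]-cong p) → ≡.cong suc (residue-cong p) ; w-refl → ≡.refl
    ; rep        = λ where zero → w ; (suc i) → w[ + toℕ i ]
    ; rep-class  = λ where w[ i ] → w[]-cong (residue-≡ i) ; w → w-refl
    }

------------------------------------------------------------------------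
-- The lattices over the dihedral group D n

module _ (n : ℕ) .{{_ : NonZero n}} where

  M̃₊ : Lattice (D n)
  M̃₊ = freeLattice (M̃₊-Construction.finite n) (M̃₊-Construction.action n)

  ℤ-trivial : Lattice (D n)
  ℤ-trivial = trivialLattice (D n)

  ℤ[D/⟨σ⟩] : Lattice (D n)
  ℤ[D/⟨σ⟩] = permutationLattice (D n) (⟨_⟩ (D n) σ) (Affine.finite-σ n)

  ℤ[D/⟨τ⟩] : Lattice (D n)
  ℤ[D/⟨τ⟩] = permutationLattice (D n) (⟨_⟩ (D n) τ) (Affine.finite-τ n)

{-# OPTIONS --safe #-}

-- Write n = 2m + 1 and let e₀, e₁ be the two cosets of ⟨σ⟩, uⱼ the coset σʲ⟨τ⟩,
-- E = e₀ + e₁ and S = Σ uⱼ.  Modulo the norm, σᵐ + σᵐ⁺¹ = σᵐ(1 + σ) is a unit of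
-- ℤ[⟨σ⟩], because n is odd: Σ_{k<m} σ²ᵏ⁺¹(1 + σ) is the norm minus 1.  It is also
-- fixed by inversion, so the equivariant map
--   1 ∈ ℤ ↦ ζ = m E + S,   w ↦ e₀ + ζ,   wᵢ ↦ uᵢ₊ₘ + uᵢ₊ₘ₊₁ + E
-- has the inverse
--   e₀ ↦ w − 1,   e₁ ↦ τ w − 1,   uⱼ ↦ 1 − Σ_{k<m} wⱼ₊₁₋ₘ₊₂ₖ.

module Submission where

open import Defs using (M̃₊; ℤ-trivial; ℤ[D/⟨σ⟩]; ℤ[D/⟨τ⟩]; _⊞_; _≅_)
open import Defs using (Additive; idᴬ; _∘ᴬ_; Comb; [_]; 𝟘; _⊕_; ⊖_; freeAbelianGroup; extendᴬ; additive-ext)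
open import Defs using (module CombEq; module Power)
open import Defs using (Lattice; Finite; Cosets; ⟨_⟩; Generator; σ′; τ′; σ; τ; D)
open import Defs using (Word; letter; εʷ; _∙ʷ_; _⁻¹ʷ; module WordEq; presented)
open import Defs using (_≡_[mod_]; mod-reflexive; mod-sym; mod-trans; mod-+; mod-n)
open import Defs using (residue-cong; residue-≡; module Affine)
open import Defs using (Basis; w[_]; w; w[]-cong; w-refl; basis; module M̃₊-Construction)
open import Data.Nat using (ℕ; zero; suc; _≤_; NonZero)
open import Data.Nat.Divisibility using (_∤_; m%n≡0⇒n∣m)
open import Algebra.Bundles using (Group; AbelianGroup)
import Algebra.Construct.DirectProduct as DirectProduct
import Algebra.Module.Properties.LeftModule as LeftModuleProperties
import Algebra.Properties.CommutativeMonoid.Mult as Mult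
import Algebra.Properties.CommutativeMonoid.Sum as Sum
import Algebra.Properties.CommutativeSemigroup as CommutativeSemigroupProperties
import Algebra.Properties.Group as GroupProperties
import Algebra.Solver.CommutativeMonoid as CommutativeMonoidSolver
open import Data.Fin.Base using (zero; suc; toℕ)
open import Data.Integer.Base as ℤ using (ℤ; +_; -[1+_]; 0ℤ; 1ℤ)
import Data.Integer.Properties as ℤ
open import Data.Integer.Tactic.RingSolver using (solve-∀)
import Data.Nat.Base as ℕ
import Data.Nat.DivMod as ℕ
open import Data.Product.Base using (_,_; proj₁; proj₂; ∃-syntax)
open import Data.Sign.Base as Sign using (Sign)
import Data.Sign.Properties as Sign
open import Function.Base using (_∘_)
open import Level using (0ℓ)
open import Relation.Binary.Bundles using (Setoid)
open import Relation.Binary.Core using (Rel)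
open import Relation.Binary.PropositionalEquality as ≡ using (_≡_)
import Relation.Binary.Reasoning.Setoid as SetoidReasoning
open import Relation.Nullary.Negation using (contradiction)

-- Sums along arithmetic progressions in an abelian group.

next : ℤ → ℤ
next a = a ℤ.+ 1ℤ

module Progressions (B : AbelianGroup 0ℓ 0ℓ) where
  open AbelianGroup B
  open CommutativeSemigroupProperties commutativeSemigroup using (interchange)
  open Mult commutativeMonoid using (_×_; ×-congʳ; ×-assocˡ; ×-idem)
  open SetoidReasoning setoid

  ×-double : ∀ k x → (k ℕ.* 2) × x ≈ k × (x ∙ x)
  ×-double k x = trans (sym (×-assocˡ x k 2)) (×-congʳ k (∙-congˡ (identityʳ x)))

  -- The step is a parameter so that the additivity and shift lemmas serve both `run`, which gives
  -- norms over ℤ/n, and `stride`, which gives the sum of even powers of σ inverting 1 + σ up to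
  -- sign and norm. Integer indices make a shift a mere change of starting point.
  along : (ℤ → ℤ) → (ℤ → Carrier) → ℤ → ℕ → Carrier
  along s u a zero    = ε
  along s u a (suc k) = u a ∙ along s u (s a) k

  run stride : (ℤ → Carrier) → ℤ → ℕ → Carrier
  run    = along next
  stride = along (next ∘ next)

  along-cong : ∀ s {u v} → (∀ a → u a ≈ v a) → ∀ a k → along s u a k ≈ along s v a k
  along-cong s e a zero    = refl
  along-cong s e a (suc k) = ∙-cong (e a) (along-cong s e (s a) k)

  along-≡ : ∀ s u {a b} → a ≡ b → ∀ k → along s u a k ≈ along s u b k
  along-≡ s u ≡.refl k = refl

  along-∙ : ∀ s u v a k → along s (λ i → u i ∙ v i) a k ≈ along s u a k ∙ along s v a k
  along-∙ s u v a zero    = sym (identityˡ ε)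
  along-∙ s u v a (suc k) = trans (∙-congˡ (along-∙ s u v (s a) k)) (interchange _ _ _ _)

  along-const : ∀ s x a k → along s (λ _ → x) a k ≈ k × x
  along-const s x a zero    = refl
  along-const s x a (suc k) = ∙-congˡ (along-const s x (s a) k)

  along-shift : ∀ s u c → (∀ a → s (a ℤ.+ c) ≡ s a ℤ.+ c) → ∀ a k →
                along s (λ i → u (i ℤ.+ c)) a k ≈ along s u (a ℤ.+ c) k
  along-shift s u c e a zero    = refl
  along-shift s u c e a (suc k) = ∙-congˡ
    (trans (along-shift s u c e (s a) k) (along-≡ s u (≡.sym (e a)) k))

  run-shift : ∀ u c a k → run (λ i → u (i ℤ.+ c)) a k ≈ run u (a ℤ.+ c) k
  run-shift u c = along-shift next u c (λ a → e a c)
    where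
    e : ∀ a c → a ℤ.+ c ℤ.+ 1ℤ ≡ a ℤ.+ 1ℤ ℤ.+ c
    e = solve-∀

  stride-shift : ∀ u c a k → stride (λ i → u (i ℤ.+ c)) a k ≈ stride u (a ℤ.+ c) k
  stride-shift u c = along-shift (next ∘ next) u c (λ a → e a c)
    where
    e : ∀ a c → a ℤ.+ c ℤ.+ 1ℤ ℤ.+ 1ℤ ≡ a ℤ.+ 1ℤ ℤ.+ 1ℤ ℤ.+ c
    e = solve-∀

  run-snoc : ∀ u a k → run u a (suc k) ≈ run u a k ∙ u (a ℤ.+ + k)
  run-snoc u a zero    = trans (comm _ _) (∙-congˡ (reflexive (≡.cong u (≡.sym (ℤ.+-identityʳ a)))))
  run-snoc u a (suc k) = begin
    u a ∙ run u (next a) (suc k)                     ≈⟨ ∙-congˡ (run-snoc u (next a) k) ⟩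
    u a ∙ (run u (next a) k ∙ u (next a ℤ.+ + k))    ≈⟨ assoc _ _ _ ⟨
    run u a (suc k) ∙ u (next a ℤ.+ + k)             ≡⟨ ≡.cong (λ i → run u a (suc k) ∙ u i) (ℤ.+-assoc a 1ℤ (+ k)) ⟩
    run u a (suc k) ∙ u (a ℤ.+ + suc k)              ∎

  -- Negation reverses the order of the indices: the last one, a + k - 1, becomes the new start 1 -
  -- a - k, and the first term becomes the last, which `run-snoc` splits off.
  run-neg : ∀ u a k → run (u ∘ ℤ.-_) a k ≈ run u (1ℤ ℤ.- a ℤ.- + k) k
  run-neg u a zero    = refl
  run-neg u a (suc k) = begin
    u (ℤ.- a) ∙ run (u ∘ ℤ.-_) (next a) k        ≈⟨ ∙-congˡ (run-neg u (next a) k) ⟩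
    u (ℤ.- a) ∙ run u (1ℤ ℤ.- next a ℤ.- + k) k  ≈⟨ comm _ _ ⟩
    run u (1ℤ ℤ.- next a ℤ.- + k) k ∙ u (ℤ.- a)  ≈⟨ ∙-cong (along-≡ next u (i₁ a (+ k)) k) (reflexive (≡.cong u (i₂ a (+ k)))) ⟩
    run u b k ∙ u (b ℤ.+ + k)                    ≈⟨ run-snoc u b k ⟨
    run u b (suc k)                              ∎
    where
    b = 1ℤ ℤ.- a ℤ.- + suc k
    i₁ : ∀ a k → 1ℤ ℤ.- (a ℤ.+ 1ℤ) ℤ.- k ≡ 1ℤ ℤ.- a ℤ.- (1ℤ ℤ.+ k)
    i₁ = solve-∀
    i₂ : ∀ a k → ℤ.- a ≡ 1ℤ ℤ.- a ℤ.- (1ℤ ℤ.+ k) ℤ.+ k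
    i₂ = solve-∀

  -- Strides from adjacent starts pick alternate terms. This is the identity (1 + σ)(1 + σ² + ... +
  -- σ²ᵏ⁻²) = 1 + σ + ... + σ²ᵏ⁻¹.
  interleave : ∀ u a k → stride u a k ∙ stride u (next a) k ≈ run u a (k ℕ.* 2)
  interleave u a zero    = identityˡ ε
  interleave u a (suc k) = begin
    (u a ∙ stride u (next (next a)) k) ∙ (u (next a) ∙ stride u (next (next (next a))) k)
      ≈⟨ interchange _ _ _ _ ⟩
    (u a ∙ u (next a)) ∙ (stride u (next (next a)) k ∙ stride u (next (next (next a))) k)
      ≈⟨ ∙-congˡ (interleave u (next (next a)) k) ⟩
    (u a ∙ u (next a)) ∙ run u (next (next a)) (k ℕ.* 2)
      ≈⟨ assoc _ _ _ ⟩
    run u a (suc k ℕ.* 2) ∎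

  sum≈run : ∀ u a k → Sum.sum commutativeMonoid {k} (λ i → u (a ℤ.+ + toℕ i)) ≈ run u a k
  sum≈run u a zero    = refl
  sum≈run u a (suc k) = ∙-cong (reflexive (≡.cong u (ℤ.+-identityʳ a))) (trans
    (Sum.sum-cong-≋ commutativeMonoid {k}
      (λ i → reflexive (≡.cong u (≡.sym (ℤ.+-assoc a 1ℤ (+ toℕ i))))))
    (sum≈run u (next a) k))

  module Periodic (p : ℕ) {u : ℤ → Carrier} (periodic : ∀ a → u (a ℤ.+ + suc p) ≈ u a) where

    -- Moving the window by one drops `u a` and adds the term one period later, which is equal to
    -- it.
    run-next : ∀ a → run u (next a) (suc p) ≈ run u a (suc p)
    run-next a = begin
      run u (next a) (suc p)                ≈⟨ run-snoc u (next a) p ⟩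
      run u (next a) p ∙ u (next a ℤ.+ + p) ≡⟨ ≡.cong (λ i → run u (next a) p ∙ u i) (ℤ.+-assoc a 1ℤ (+ p)) ⟩
      run u (next a) p ∙ u (a ℤ.+ + suc p)  ≈⟨ ∙-congˡ (periodic a) ⟩
      run u (next a) p ∙ u a                ≈⟨ comm _ _ ⟩
      run u a (suc p)                       ∎

    run-invariant : ∀ a → run u a (suc p) ≈ run u 0ℤ (suc p)
    run-invariant (+ zero)  = refl
    run-invariant (+ suc k) = trans
      (trans (along-≡ next u (ℤ.+-comm 1ℤ (+ k)) (suc p)) (run-next (+ k)))
      (run-invariant (+ k))
    -- On the negative side `next` computes to the index nearer 0, so unlike the positive case no
    -- rewriting of the start is needed.
    run-invariant -[1+ zero ]  = sym (run-next -[1+ 0 ])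
    run-invariant -[1+ suc k ] = trans (sym (run-next -[1+ suc k ])) (run-invariant -[1+ k ])

    run-reflect : run (u ∘ ℤ.-_) 0ℤ (suc p) ≈ run u 0ℤ (suc p)
    run-reflect = trans (run-neg u 0ℤ (suc p)) (run-invariant _)

    -- Exchanging the two summations turns each of the k terms of the stride into a sum over a full
    -- period, and all these sums agree by `run-invariant`.
    run-stride : ∀ a k → run (λ i → stride u i k) a (suc p) ≈ k × run u 0ℤ (suc p)
    run-stride a zero    = trans (along-const next ε a (suc p)) (×-idem (identityˡ ε) (suc p))
    run-stride a (suc k) = begin
      run (λ i → u i ∙ stride u (next (next i)) k) a (suc p)
        ≈⟨ along-∙ next u (λ i → stride u (next (next i)) k) a (suc p) ⟩
      run u a (suc p) ∙ run (λ i → stride u (next (next i)) k) a (suc p)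
        ≈⟨ ∙-cong (run-invariant a) (trans (run-shift (λ i → stride u (next i) k) 1ℤ a (suc p))
             (run-shift (λ i → stride u i k) 1ℤ (next a) (suc p))) ⟩
      run u 0ℤ (suc p) ∙ run (λ i → stride u i k) (next (next a)) (suc p)
        ≈⟨ ∙-congˡ (run-stride (next (next a)) k) ⟩
      suc k × run u 0ℤ (suc p) ∎

-- Additive maps commute with progression sums and multiples.

module _ {A B : AbelianGroup 0ℓ 0ℓ} (f : Additive A B) where
  private
    module A = AbelianGroup A
    module B = AbelianGroup B
    module PA = Progressions A
    module PB = Progressions B
    open Additive f
    open Mult A.commutativeMonoid using () renaming (_×_ to _×A_)
    open Mult B.commutativeMonoid using () renaming (_×_ to _×B_)

  along-homo : ∀ s u a k → fun (PA.along s u a k) B.≈ PB.along s (fun ∘ u) a k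
  along-homo s u a zero    = ε-homo
  along-homo s u a (suc k) = B.trans (homo _ _) (B.∙-congˡ (along-homo s u (s a) k))

  ×-homo : ∀ k x → fun (k ×A x) B.≈ k ×B fun x
  ×-homo zero    x = ε-homo
  ×-homo (suc k) x = B.trans (homo _ _) (B.∙-congˡ (×-homo k x))

-- Sums of the prescribed images in the target.

-- ω i is the image of wᵢ.
module Target (m : ℕ) (B : AbelianGroup 0ℓ 0ℓ)
              (e₀ e₁ : AbelianGroup.Carrier B) (u : ℤ → AbelianGroup.Carrier B)
              (u-periodic : ∀ a → AbelianGroup._≈_ B (u (a ℤ.+ + suc (m ℕ.* 2))) (u a)) where
  open AbelianGroup B
  open Progressions B
  open Periodic (m ℕ.* 2) u-periodic
  open Mult commutativeMonoid using (_×_; ×-congʳ; ×-distrib-+)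
  open CommutativeMonoidSolver commutativeMonoid using (solve; _⊜_; id) renaming (_⊕_ to _⊗_)
  open SetoidReasoning setoid

  n : ℕ
  n = suc (m ℕ.* 2)

  E S ζ : Carrier
  E = e₀ ∙ e₁
  S = run u 0ℤ n
  ζ = m × E ∙ S

  ω : ℤ → Carrier
  ω i = (u (i ℤ.+ + m) ∙ u (next i ℤ.+ + m)) ∙ E

  -- Each u occurs twice and E occurs n times; as n = 2m + 1, the total 2S + nE equals E + 2ζ. This
  -- is what makes -w + Σ wᵢ go to e₁ + ζ when w goes to e₀ + ζ.
  run-ω : run ω 0ℤ n ≈ (e₀ ∙ ζ) ∙ (e₁ ∙ ζ)
  run-ω = begin
    run ω 0ℤ n
      ≈⟨ along-∙ next _ (λ _ → E) 0ℤ n ⟩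
    run (λ i → u (i ℤ.+ + m) ∙ u (next i ℤ.+ + m)) 0ℤ n ∙ run (λ _ → E) 0ℤ n
      ≈⟨ ∙-cong (along-∙ next _ _ 0ℤ n) (along-const next E 0ℤ n) ⟩
    (run (λ i → u (i ℤ.+ + m)) 0ℤ n ∙ run (λ i → u (next i ℤ.+ + m)) 0ℤ n) ∙ n × E
      ≈⟨ ∙-congʳ (∙-cong (S-shift 0ℤ)
           (trans (run-shift (λ i → u (i ℤ.+ + m)) 1ℤ 0ℤ n) (S-shift 1ℤ))) ⟩
    (S ∙ S) ∙ (E ∙ (m ℕ.* 2) × E)
      ≈⟨ ∙-congˡ (∙-congˡ (trans (×-double m E) (×-distrib-+ E E m))) ⟩
    (S ∙ S) ∙ (E ∙ (m × E ∙ m × E))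
      ≈⟨ solve 4 (λ S X a b → (S ⊗ S) ⊗ ((a ⊗ b) ⊗ (X ⊗ X)) ⊜ (a ⊗ (X ⊗ S)) ⊗ (b ⊗ (X ⊗ S)))
           refl S (m × E) e₀ e₁ ⟩
    (e₀ ∙ ζ) ∙ (e₁ ∙ ζ) ∎
    where
    S-shift : ∀ a → run (λ i → u (i ℤ.+ + m)) a n ≈ S
    S-shift a = trans (run-shift u (+ m) a n) (run-invariant _)

  -- The m summands of the stride contain u at the indices j + 1, ..., j + 2m exactly once each,
  -- together with m copies of E; `u j` completes the period.
  stride-ω : ∀ j → u j ∙ stride ω (j ℤ.+ 1ℤ ℤ.- + m) m ≈ ζ
  stride-ω j = begin
    u j ∙ stride ω b m
      ≈⟨ ∙-congˡ (trans (along-∙ _ _ (λ _ → E) b m) (∙-cong (along-∙ _ _ _ b m) (along-const _ E b m))) ⟩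
    u j ∙ ((stride (λ i → u (i ℤ.+ + m)) b m ∙ stride (λ i → u (next i ℤ.+ + m)) b m) ∙ m × E)
      ≈⟨ ∙-congˡ (∙-congʳ (∙-cong (lemma b (next j) (i₁ j (+ m)))
           (trans (stride-shift (λ i → u (i ℤ.+ + m)) 1ℤ b m) (lemma (next b) (next (next j)) (i₂ j (+ m)))))) ⟩
    u j ∙ ((stride u (next j) m ∙ stride u (next (next j)) m) ∙ m × E)
      ≈⟨ ∙-congˡ (∙-congʳ (interleave u (next j) m)) ⟩
    u j ∙ (run u (next j) (m ℕ.* 2) ∙ m × E)
      ≈⟨ assoc _ _ _ ⟨
    run u j n ∙ m × E
      ≈⟨ trans (∙-congʳ (run-invariant j)) (comm _ _) ⟩
    ζ ∎
    where
    -- Subtracting m cancels the shift by m built into `ω`, so the covered indices start at j + 1.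
    b = j ℤ.+ 1ℤ ℤ.- + m
    lemma : ∀ a c → a ℤ.+ + m ≡ c → stride (λ i → u (i ℤ.+ + m)) a m ≈ stride u c m
    lemma a _ ≡.refl = stride-shift u (+ m) a m
    i₁ : ∀ j m → j ℤ.+ 1ℤ ℤ.- m ℤ.+ m ≡ j ℤ.+ 1ℤ
    i₁ = solve-∀
    i₂ : ∀ j m → j ℤ.+ 1ℤ ℤ.- m ℤ.+ 1ℤ ℤ.+ m ≡ j ℤ.+ 1ℤ ℤ.+ 1ℤ
    i₂ = solve-∀

  -- Behaviour of the images under rotation and reflection.

  module _ (β : Additive B B) where
    open Additive β

    fix-ζ : fun E ≈ E → fun S ≈ S → fun ζ ≈ ζ
    fix-ζ p q = trans (homo _ _) (∙-cong (trans (×-homo β m E) (×-congʳ m p)) q)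

    module Rotation (β-e₀ : fun e₀ ≈ e₀) (β-e₁ : fun e₁ ≈ e₁) (β-u : ∀ a → fun (u a) ≈ u (next a)) where

      rotate-E : fun E ≈ E
      rotate-E = trans (homo _ _) (∙-cong β-e₀ β-e₁)

      rotate-ζ : fun ζ ≈ ζ
      rotate-ζ = fix-ζ rotate-E (trans (along-homo β next u 0ℤ n)
        (trans (along-cong next β-u 0ℤ n) (trans (run-shift u 1ℤ 0ℤ n) (run-next 0ℤ))))

      rotate-ω : ∀ i → fun (ω i) ≈ ω (next i)
      rotate-ω i = trans (homo _ _) (∙-cong (trans (homo _ _) (∙-cong (lemma i) (lemma (next i)))) rotate-E)
        where
        e : ∀ i m → i ℤ.+ m ℤ.+ 1ℤ ≡ i ℤ.+ 1ℤ ℤ.+ m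
        e = solve-∀
        lemma : ∀ i → fun (u (i ℤ.+ + m)) ≈ u (next i ℤ.+ + m)
        lemma i = trans (β-u _) (reflexive (≡.cong u (e i (+ m))))

      rotate-e₀∙ζ : fun (e₀ ∙ ζ) ≈ e₀ ∙ ζ
      rotate-e₀∙ζ = trans (homo _ _) (∙-cong β-e₀ rotate-ζ)

    module Reflection (β-e₀ : fun e₀ ≈ e₁) (β-e₁ : fun e₁ ≈ e₀) (β-u : ∀ a → fun (u a) ≈ u (ℤ.- a)) where

      reflect-E : fun E ≈ E
      reflect-E = trans (homo _ _) (trans (∙-cong β-e₀ β-e₁) (comm _ _))

      reflect-ζ : fun ζ ≈ ζ
      reflect-ζ = fix-ζ reflect-E (trans (along-homo β next u 0ℤ n)
        (trans (along-cong next β-u 0ℤ n) run-reflect))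

      reflect-e₀∙ζ : fun (e₀ ∙ ζ) ≈ e₁ ∙ ζ
      reflect-e₀∙ζ = trans (homo _ _) (∙-cong β-e₀ reflect-ζ)

      -- Negating i + m and i + m + 1 and adding the period 2m + 1 gives -i + m + 1 and -i + m, the
      -- same pair for -i in reverse order. The shift by m in `ω` is chosen for this symmetry.
      reflect-ω : ∀ i → fun (ω i) ≈ ω (ℤ.- i)
      reflect-ω i = trans (homo _ _) (∙-cong (trans (homo _ _) (trans (∙-cong
          (trans (β-u _) (lemma (i₁ i (+ m))))
          (trans (β-u _) (lemma (i₂ i (+ m)))))
          (comm _ _))) reflect-E)
        where
        -- The period is written as 1 + m * 2 in ℤ, so that the required index equations are ring
        -- identities; `pos-*` translates back.
        lemma : ∀ {a b} → b ≡ a ℤ.+ (1ℤ ℤ.+ + m ℤ.* + 2) → u a ≈ u b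
        lemma {a} ≡.refl = sym (trans
          (reflexive (≡.cong (λ k → u (a ℤ.+ (1ℤ ℤ.+ k))) (≡.sym (ℤ.pos-* m 2)))) (u-periodic a))
        i₁ : ∀ i m → ℤ.- i ℤ.+ 1ℤ ℤ.+ m ≡ ℤ.- (i ℤ.+ m) ℤ.+ (1ℤ ℤ.+ m ℤ.* + 2)
        i₁ = solve-∀
        i₂ : ∀ i m → ℤ.- i ℤ.+ m ≡ ℤ.- (i ℤ.+ 1ℤ ℤ.+ m) ℤ.+ (1ℤ ℤ.+ m ℤ.* + 2)
        i₂ = solve-∀

-- Relations among the prescribed images in the source.

-- x i, y and z stand for wᵢ, w and 1 ∈ ℤ; ε₀, ε₁ and υ j are the images of e₀, e₁ and uⱼ.
module Source (m : ℕ) (A : AbelianGroup 0ℓ 0ℓ)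
              (x : ℤ → AbelianGroup.Carrier A) (y z : AbelianGroup.Carrier A)
              (x-periodic : ∀ a → AbelianGroup._≈_ A (x (a ℤ.+ + suc (m ℕ.* 2))) (x a)) where
  open AbelianGroup A
  open Progressions A
  open Periodic (m ℕ.* 2) x-periodic
  open GroupProperties group using (∙-cancelʳ; //-rightDividesˡ)
  open Mult commutativeMonoid using (_×_; ×-congʳ; ×-distrib-+)
  open CommutativeMonoidSolver commutativeMonoid using (solve; _⊜_; id) renaming (_⊕_ to _⊗_)
  open SetoidReasoning setoid

  n : ℕ
  n = suc (m ℕ.* 2)

  Σx : Carrier
  Σx = run x 0ℤ n

  ε₀ ε₁ : Carrier
  ε₀ = y ∙ z ⁻¹
  ε₁ = (y ⁻¹ ∙ Σx) ∙ z ⁻¹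

  υ : ℤ → Carrier
  υ j = z ∙ (stride x (j ℤ.+ 1ℤ ℤ.- + m) m) ⁻¹

  -- With y standing for w, the element `y ⁻¹ ∙ Σx` is τ w, so this is the relation w + τ w = Σ wᵢ
  -- after the two subtracted copies of z are restored.
  ε₀∙ε₁∙z∙z : (ε₀ ∙ ε₁) ∙ (z ∙ z) ≈ Σx
  ε₀∙ε₁∙z∙z = begin
    ((y ∙ z ⁻¹) ∙ ((y ⁻¹ ∙ Σx) ∙ z ⁻¹)) ∙ (z ∙ z)
      -- The solver knows only commutative monoids, so inverses enter as independent variables and
      -- are cancelled in the following step.
      ≈⟨ solve 5 (λ y y′ z z′ s → ((y ⊗ z′) ⊗ ((y′ ⊗ s) ⊗ z′)) ⊗ (z ⊗ z) ⊜ ((y ⊗ y′) ⊗ ((z′ ⊗ z) ⊗ (z′ ⊗ z))) ⊗ s)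
           refl y (y ⁻¹) z (z ⁻¹) Σx ⟩
    ((y ∙ y ⁻¹) ∙ ((z ⁻¹ ∙ z) ∙ (z ⁻¹ ∙ z))) ∙ Σx
      ≈⟨ ∙-congʳ (∙-cong (inverseʳ y) (∙-cong (inverseˡ z) (inverseˡ z))) ⟩
    (ε ∙ (ε ∙ ε)) ∙ Σx
      ≈⟨ solve 1 (λ s → (id ⊗ (id ⊗ id)) ⊗ s ⊜ s) refl Σx ⟩
    Σx ∎

  υ-stride : ∀ j → υ j ∙ stride x (j ℤ.+ 1ℤ ℤ.- + m) m ≈ z
  υ-stride j = //-rightDividesˡ _ z

  -- This gives g (f wᵢ) = wᵢ. The strides subtracted by the two υ interleave to every x of the
  -- period except `x i`, while ε₀ + ε₁ contributes Σx - 2z and the υ contribute 2z.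
  υ∙υ∙ε₀∙ε₁ : ∀ i → (υ (i ℤ.+ + m) ∙ υ (next i ℤ.+ + m)) ∙ (ε₀ ∙ ε₁) ≈ x i
  -- Adding the other 2m terms of the period and 2z to both sides removes all subtractions, leaving
  -- monoid identities.
  υ∙υ∙ε₀∙ε₁ i = ∙-cancelʳ (run x (next i) (m ℕ.* 2) ∙ (z ∙ z)) _ _ (begin
    ((υ a ∙ υ b) ∙ (ε₀ ∙ ε₁)) ∙ (run x (next i) (m ℕ.* 2) ∙ (z ∙ z))
      ≈⟨ ∙-congˡ (∙-congʳ (interleave x (next i) m)) ⟨
    ((υ a ∙ υ b) ∙ (ε₀ ∙ ε₁)) ∙ ((stride x (next i) m ∙ stride x (next (next i)) m) ∙ (z ∙ z))
      ≈⟨ solve 6 (λ a b e s t z → ((a ⊗ b) ⊗ e) ⊗ ((s ⊗ t) ⊗ z) ⊜ ((a ⊗ s) ⊗ (b ⊗ t)) ⊗ (e ⊗ z))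
           refl (υ a) (υ b) (ε₀ ∙ ε₁) _ _ (z ∙ z) ⟩
    ((υ a ∙ stride x (next i) m) ∙ (υ b ∙ stride x (next (next i)) m)) ∙ ((ε₀ ∙ ε₁) ∙ (z ∙ z))
      ≈⟨ ∙-cong (∙-cong (lemma i) (lemma (next i))) ε₀∙ε₁∙z∙z ⟩
    (z ∙ z) ∙ Σx
      ≈⟨ ∙-congˡ (run-invariant i) ⟨
    (z ∙ z) ∙ (x i ∙ run x (next i) (m ℕ.* 2))
      ≈⟨ solve 3 (λ z x r → z ⊗ (x ⊗ r) ⊜ x ⊗ (r ⊗ z)) refl (z ∙ z) (x i) _ ⟩
    x i ∙ (run x (next i) (m ℕ.* 2) ∙ (z ∙ z)) ∎)
    where
    a = i ℤ.+ + m
    b = next i ℤ.+ + m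
    e : ∀ i m → i ℤ.+ 1ℤ ≡ i ℤ.+ m ℤ.+ 1ℤ ℤ.- m
    e = solve-∀
    lemma : ∀ i → υ (i ℤ.+ + m) ∙ stride x (next i) m ≈ z
    lemma i = trans (∙-congˡ (along-≡ _ x (e i (+ m)) m)) (υ-stride (i ℤ.+ + m))

  -- The υ sum to nz - mΣx: the subtracted strides have m terms each and run through all n starting
  -- points, so `run-stride` applies.
  run-υ : run υ 0ℤ n ∙ m × Σx ≈ n × z
  run-υ = begin
    run υ 0ℤ n ∙ m × Σx
      ≈⟨ ∙-congˡ (run-stride (0ℤ ℤ.+ 1ℤ ℤ.- + m) m) ⟨
    run υ 0ℤ n ∙ run (λ i → stride x i m) (0ℤ ℤ.+ 1ℤ ℤ.- + m) n
      ≈⟨ ∙-congˡ (trans (run-shift (λ i → stride x (i ℤ.- + m) m) 1ℤ 0ℤ n)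
                        (run-shift (λ i → stride x i m) (ℤ.- + m) 1ℤ n)) ⟨
    run υ 0ℤ n ∙ run (λ j → stride x (j ℤ.+ 1ℤ ℤ.- + m) m) 0ℤ n
      ≈⟨ along-∙ next υ _ 0ℤ n ⟨
    run (λ j → υ j ∙ stride x (j ℤ.+ 1ℤ ℤ.- + m) m) 0ℤ n
      ≈⟨ along-cong next υ-stride 0ℤ n ⟩
    run (λ _ → z) 0ℤ n
      ≈⟨ along-const next z 0ℤ n ⟩
    n × z ∎

  m×ε₀∙ε₁ : m × (ε₀ ∙ ε₁) ∙ (m ℕ.* 2) × z ≈ m × Σx
  m×ε₀∙ε₁ = begin
    m × (ε₀ ∙ ε₁) ∙ (m ℕ.* 2) × z   ≈⟨ ∙-congˡ (×-double m z) ⟩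
    m × (ε₀ ∙ ε₁) ∙ m × (z ∙ z)     ≈⟨ ×-distrib-+ (ε₀ ∙ ε₁) (z ∙ z) m ⟨
    m × ((ε₀ ∙ ε₁) ∙ (z ∙ z))       ≈⟨ ×-congʳ m ε₀∙ε₁∙z∙z ⟩
    m × Σx                          ∎

  -- This gives g ζ = z: the sum (mΣx - 2mz) + (nz - mΣx) collapses to z because n = 2m + 1.
  recover-z : m × (ε₀ ∙ ε₁) ∙ run υ 0ℤ n ≈ z
  recover-z = ∙-cancelʳ (m × Σx) _ _ (begin
    (m × (ε₀ ∙ ε₁) ∙ run υ 0ℤ n) ∙ m × Σx     ≈⟨ assoc _ _ _ ⟩
    m × (ε₀ ∙ ε₁) ∙ (run υ 0ℤ n ∙ m × Σx)     ≈⟨ ∙-congˡ run-υ ⟩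
    m × (ε₀ ∙ ε₁) ∙ (z ∙ (m ℕ.* 2) × z)
      ≈⟨ solve 3 (λ a b c → a ⊗ (b ⊗ c) ⊜ b ⊗ (a ⊗ c)) refl _ z _ ⟩
    z ∙ (m × (ε₀ ∙ ε₁) ∙ (m ℕ.* 2) × z)       ≈⟨ ∙-congˡ m×ε₀∙ε₁ ⟩
    z ∙ m × Σx                                ∎)

-- The two maps are mutually inverse on generators.

module Exchange (m : ℕ) (A B : AbelianGroup 0ℓ 0ℓ)
  (x : ℤ → AbelianGroup.Carrier A) (y z : AbelianGroup.Carrier A)
  (x-periodic : ∀ a → AbelianGroup._≈_ A (x (a ℤ.+ + suc (m ℕ.* 2))) (x a))
  (e₀ e₁ : AbelianGroup.Carrier B) (u : ℤ → AbelianGroup.Carrier B)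
  (u-periodic : ∀ a → AbelianGroup._≈_ B (u (a ℤ.+ + suc (m ℕ.* 2))) (u a))
  where
  private
    module A = AbelianGroup A
    module B = AbelianGroup B
    module PA = Progressions A
    module PB = Progressions B

  open Target m B e₀ e₁ u u-periodic
  open Source m A x y z x-periodic hiding (n)

  -- Only values on the generators are recorded, so the inversion is checked in arbitrary abelian
  -- groups, apart from group actions and coset representatives.
  record Maps : Set where
    field
      f    : Additive A B
      g    : Additive B A
      f-x  : ∀ i → Additive.fun f (x i) B.≈ ω i
      f-y  : Additive.fun f y B.≈ e₀ B.∙ ζ
      f-z  : Additive.fun f z B.≈ ζ
      g-e₀ : Additive.fun g e₀ A.≈ ε₀
      g-e₁ : Additive.fun g e₁ A.≈ ε₁
      g-u  : ∀ a → Additive.fun g (u a) A.≈ υ a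

    private
      module f = Additive f
      module g = Additive g

    f-Σx : f.fun Σx B.≈ (e₀ B.∙ ζ) B.∙ (e₁ B.∙ ζ)
    f-Σx = B.trans (along-homo f next x 0ℤ n) (B.trans (PB.along-cong next f-x 0ℤ n) run-ω)

    f∘g-e₀ : f.fun (g.fun e₀) B.≈ e₀
    f∘g-e₀ = begin
      f.fun (g.fun e₀)               ≈⟨ f.cong g-e₀ ⟩
      f.fun (y A.∙ z A.⁻¹)           ≈⟨ f.homo _ _ ⟩
      f.fun y B.∙ f.fun (z A.⁻¹)     ≈⟨ B.∙-cong f-y (B.trans (f.⁻¹-homo z) (B.⁻¹-cong f-z)) ⟩
      (e₀ B.∙ ζ) B.∙ ζ B.⁻¹          ≈⟨ GroupProperties.//-rightDividesʳ B.group ζ e₀ ⟩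
      e₀                             ∎
      where open SetoidReasoning B.setoid

    -- The argument is τ w. By `run-ω` the image of Σx is the image of y plus e₁ + ζ, so only the
    -- latter remains. Needed both for e₁ and for equivariance at w.
    f-τy : f.fun (y A.⁻¹ A.∙ Σx) B.≈ e₁ B.∙ ζ
    f-τy = begin
      f.fun (y A.⁻¹ A.∙ Σx)              ≈⟨ f.homo _ _ ⟩
      f.fun (y A.⁻¹) B.∙ f.fun Σx        ≈⟨ B.∙-cong (B.trans (f.⁻¹-homo y) (B.⁻¹-cong f-y)) f-Σx ⟩
      (e₀ B.∙ ζ) B.⁻¹ B.∙ ((e₀ B.∙ ζ) B.∙ (e₁ B.∙ ζ)) ≈⟨ GroupProperties.\\-leftDividesʳ B.group (e₀ B.∙ ζ) _ ⟩
      e₁ B.∙ ζ                           ∎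
      where open SetoidReasoning B.setoid

    f∘g-e₁ : f.fun (g.fun e₁) B.≈ e₁
    f∘g-e₁ = begin
      f.fun (g.fun e₁)                            ≈⟨ f.cong g-e₁ ⟩
      f.fun ((y A.⁻¹ A.∙ Σx) A.∙ z A.⁻¹)          ≈⟨ f.homo _ _ ⟩
      f.fun (y A.⁻¹ A.∙ Σx) B.∙ f.fun (z A.⁻¹)    ≈⟨ B.∙-cong f-τy (B.trans (f.⁻¹-homo z) (B.⁻¹-cong f-z)) ⟩
      (e₁ B.∙ ζ) B.∙ ζ B.⁻¹                       ≈⟨ GroupProperties.//-rightDividesʳ B.group ζ e₁ ⟩
      e₁                                          ∎
      where open SetoidReasoning B.setoid

    -- Applying f to `υ-stride` shows that the image of `υ j` solves the same equation as `u j` does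
    -- in `stride-ω`; the common stride cancels.
    f∘g-u : ∀ j → f.fun (g.fun (u j)) B.≈ u j
    f∘g-u j = GroupProperties.∙-cancelʳ B.group (PB.stride ω b m) _ _ (begin
      f.fun (g.fun (u j)) B.∙ PB.stride ω b m   ≈⟨ B.∙-cong (f.cong (g-u j)) (B.sym (B.trans
                                                     (along-homo f _ x b m) (PB.along-cong _ f-x b m))) ⟩
      f.fun (υ j) B.∙ f.fun (PA.stride x b m)   ≈⟨ f.homo _ _ ⟨
      f.fun (υ j A.∙ PA.stride x b m)           ≈⟨ f.cong (υ-stride j) ⟩
      f.fun z                                   ≈⟨ f-z ⟩
      ζ                                         ≈⟨ stride-ω j ⟨
      u j B.∙ PB.stride ω b m                   ∎)
      where
      open SetoidReasoning B.setoid
      b = j ℤ.+ 1ℤ ℤ.- + m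

    g-E : g.fun E A.≈ ε₀ A.∙ ε₁
    g-E = A.trans (g.homo _ _) (A.∙-cong g-e₀ g-e₁)

    g-ζ : g.fun ζ A.≈ z
    g-ζ = A.trans (g.homo _ _) (A.trans (A.∙-cong
      (A.trans (×-homo g m E) (Mult.×-congʳ A.commutativeMonoid m g-E))
      (A.trans (along-homo g next u 0ℤ n) (PA.along-cong next g-u 0ℤ n))) recover-z)

    g∘f-x : ∀ i → g.fun (f.fun (x i)) A.≈ x i
    g∘f-x i = A.trans (g.cong (f-x i)) (A.trans (g.homo _ _) (A.trans (A.∙-cong
      (A.trans (g.homo _ _) (A.∙-cong (g-u _) (g-u _))) g-E) (υ∙υ∙ε₀∙ε₁ i)))

    g∘f-y : g.fun (f.fun y) A.≈ y
    g∘f-y = A.trans (g.cong f-y) (A.trans (g.homo _ _) (A.trans (A.∙-cong g-e₀ g-ζ)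
      (GroupProperties.//-rightDividesˡ A.group z y)))

-- Lattice isomorphisms over a presented group from maps commuting with the generators.

module _ {I : Set} {Relator : Rel (Word I) 0ℓ} (L L′ : Lattice (presented Relator)) where
  private
    module L = Lattice L
    module L′ = Lattice L′
    module P = LeftModuleProperties L.leftModule
    module P′ = LeftModuleProperties L′.leftModule

  module _ (f : Additive L.+ᴹ-abelianGroup L′.+ᴹ-abelianGroup)
           (letter-homo : ∀ i x → Additive.fun f ([ letter i ] L.*ₗ x) L′.≈ᴹ
                                  [ letter i ] L′.*ₗ Additive.fun f x) where
    open Additive f
    open SetoidReasoning L′.≈ᴹ-setoid

    word-homo : ∀ g x → fun ([ g ] L.*ₗ x) L′.≈ᴹ [ g ] L′.*ₗ fun x
    word-homo (letter i) x = letter-homo i x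
    word-homo εʷ       x = L′.≈ᴹ-trans (cong (L.*ₗ-identityˡ x)) (L′.≈ᴹ-sym (L′.*ₗ-identityˡ _))
    word-homo (g ∙ʷ h) x = begin
      fun ([ g ∙ʷ h ] L.*ₗ x)              ≈⟨ cong (L.*ₗ-assoc [ g ] [ h ] x) ⟩
      fun ([ g ] L.*ₗ [ h ] L.*ₗ x)        ≈⟨ word-homo g _ ⟩
      [ g ] L′.*ₗ fun ([ h ] L.*ₗ x)       ≈⟨ L′.*ₗ-congˡ (word-homo h x) ⟩
      [ g ] L′.*ₗ [ h ] L′.*ₗ fun x        ≈⟨ L′.*ₗ-assoc [ g ] [ h ] _ ⟨
      [ g ∙ʷ h ] L′.*ₗ fun x               ∎
    -- Equivariance under g is used at y = g⁻¹ x, where g y = x, and g⁻¹ is then applied to both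
    -- sides.
    word-homo (g ⁻¹ʷ)  x = begin
      fun y                                    ≈⟨ L′.*ₗ-identityˡ _ ⟨
      [ εʷ ] L′.*ₗ fun y                       ≈⟨ L′.*ₗ-congʳ (CombEq.[]-cong (WordEq.inverseˡ g)) ⟨
      [ g ⁻¹ʷ ∙ʷ g ] L′.*ₗ fun y               ≈⟨ L′.*ₗ-assoc [ g ⁻¹ʷ ] [ g ] _ ⟩
      [ g ⁻¹ʷ ] L′.*ₗ [ g ] L′.*ₗ fun y        ≈⟨ L′.*ₗ-congˡ (word-homo g y) ⟨
      [ g ⁻¹ʷ ] L′.*ₗ fun ([ g ] L.*ₗ y)       ≈⟨ L′.*ₗ-congˡ (cong (L.*ₗ-assoc [ g ] [ g ⁻¹ʷ ] x)) ⟨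
      [ g ⁻¹ʷ ] L′.*ₗ fun ([ g ∙ʷ g ⁻¹ʷ ] L.*ₗ x) ≈⟨ L′.*ₗ-congˡ (cong (L.*ₗ-congʳ (CombEq.[]-cong (WordEq.inverseʳ g)))) ⟩
      [ g ⁻¹ʷ ] L′.*ₗ fun ([ εʷ ] L.*ₗ x)      ≈⟨ L′.*ₗ-congˡ (cong (L.*ₗ-identityˡ x)) ⟩
      [ g ⁻¹ʷ ] L′.*ₗ fun x                    ∎
      where y = [ g ⁻¹ʷ ] L.*ₗ x

    *ₗ-homo : ∀ r x → fun (r L.*ₗ x) L′.≈ᴹ r L′.*ₗ fun x
    *ₗ-homo [ g ]   x = word-homo g x
    *ₗ-homo 𝟘       x = L′.≈ᴹ-trans (cong (L.*ₗ-zeroˡ x)) (L′.≈ᴹ-trans ε-homo (L′.≈ᴹ-sym (L′.*ₗ-zeroˡ _)))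
    *ₗ-homo (r ⊕ s) x = begin
      fun ((r ⊕ s) L.*ₗ x)                 ≈⟨ cong (L.*ₗ-distribʳ x r s) ⟩
      fun (r L.*ₗ x L.+ᴹ s L.*ₗ x)         ≈⟨ homo _ _ ⟩
      fun (r L.*ₗ x) L′.+ᴹ fun (s L.*ₗ x)  ≈⟨ L′.+ᴹ-cong (*ₗ-homo r x) (*ₗ-homo s x) ⟩
      r L′.*ₗ fun x L′.+ᴹ s L′.*ₗ fun x    ≈⟨ L′.*ₗ-distribʳ _ r s ⟨
      (r ⊕ s) L′.*ₗ fun x                  ∎
    -- In an abstract module (-r) x = -(r x) has to be derived: both are inverse to r x.
    *ₗ-homo (⊖ r)   x = begin
      fun ((⊖ r) L.*ₗ x)     ≈⟨ cong (P.inverseˡ-uniqueᴹ _ _ (L.≈ᴹ-trans (L.≈ᴹ-sym (L.*ₗ-distribʳ x (⊖ r) r))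
                                  (L.≈ᴹ-trans (L.*ₗ-congʳ (CombEq.inverseˡ r)) (L.*ₗ-zeroˡ x)))) ⟩
      fun (L.-ᴹ (r L.*ₗ x))  ≈⟨ ⁻¹-homo _ ⟩
      L′.-ᴹ fun (r L.*ₗ x)   ≈⟨ L′.-ᴹ‿cong (*ₗ-homo r x) ⟩
      L′.-ᴹ (r L′.*ₗ fun x)  ≈⟨ P′.inverseˡ-uniqueᴹ _ _ (L′.≈ᴹ-trans (L′.≈ᴹ-sym (L′.*ₗ-distribʳ _ (⊖ r) r))
                                  (L′.≈ᴹ-trans (L′.*ₗ-congʳ (CombEq.inverseˡ r)) (L′.*ₗ-zeroˡ _))) ⟨
      (⊖ r) L′.*ₗ fun x      ∎

    ≅-intro : (g : Additive L′.+ᴹ-abelianGroup L.+ᴹ-abelianGroup) →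
              (∀ x → fun (Additive.fun g x) L′.≈ᴹ x) →
              (∀ x → Additive.fun g (fun x) L.≈ᴹ x) → L ≅ L′
    ≅-intro g f∘g g∘f = fun , record
      { isLeftModuleMonomorphism = record
        { isLeftModuleHomomorphism = record
          { +ᴹ-isGroupHomomorphism = record
            { isMonoidHomomorphism = record
              { isMagmaHomomorphism = record { isRelHomomorphism = record { cong = cong } ; homo = homo }
              ; ε-homo = ε-homo
              }
            ; ⁻¹-homo = ⁻¹-homo
            }
          ; *ₗ-homo = *ₗ-homo
          }
        ; injective = λ {x} {y} e → L.≈ᴹ-trans (L.≈ᴹ-sym (g∘f x)) (L.≈ᴹ-trans (Additive.cong g e) (g∘f y))
        }
      ; surjective = λ y → Additive.fun g y , λ e → L′.≈ᴹ-trans (cong e) (f∘g y)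
      }

-- Additive maps determined by generators, and direct sums.

elementᴬ : {G : Group 0ℓ 0ℓ} (L : Lattice G) → Group.Carrier G →
          Additive (Lattice.+ᴹ-abelianGroup L) (Lattice.+ᴹ-abelianGroup L)
elementᴬ L g = record { fun = [ g ] L.*ₗ_ ; cong = L.*ₗ-congˡ ; homo = L.*ₗ-distribˡ [ g ] }
  where
  module L = Lattice L

module _ (B : AbelianGroup 0ℓ 0ℓ) where
  private module B = AbelianGroup B
  open Power B.group

  powers : B.Carrier → Additive ℤ.+-0-abelianGroup B
  powers b = record { fun = b ^_ ; cong = ^-≡ b ; homo = ^-homo-+ b }

  -- Every integer z is the z-fold multiple of 1, and additive maps preserve multiples.
  ℤ-additive-ext : (φ ψ : Additive ℤ.+-0-abelianGroup B) →
                   Additive.fun φ 1ℤ B.≈ Additive.fun ψ 1ℤ → ∀ z → Additive.fun φ z B.≈ Additive.fun ψ z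
  ℤ-additive-ext φ ψ e z = B.trans (value φ) (B.trans (^-cong z e) (B.sym (value ψ)))
    where
    module Z = Power (AbelianGroup.group ℤ.+-0-abelianGroup)
    1^ℕ : ∀ k → 1ℤ Z.^ℕ k ≡ + k
    1^ℕ zero    = ≡.refl
    1^ℕ (suc k) = ≡.cong ℤ.suc (1^ℕ k)
    1^ : ∀ z → 1ℤ Z.^ z ≡ z
    1^ (+ k)    = 1^ℕ k
    1^ -[1+ k ] = ≡.cong ℤ.-_ (1^ℕ (suc k))
    value : ∀ φ → Additive.fun φ z B.≈ Additive.fun φ 1ℤ ^ z
    value φ = B.trans (Additive.cong φ (≡.sym (1^ z))) (Additive.^-homo φ 1ℤ z)

  -- Each basis element equals its class representative, so on the coset lattices only e₀, e₁ and
  -- the finitely many uⱼ need checking.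
  additive-ext-rep : {X : Setoid 0ℓ 0ℓ} (fin : Finite X) (φ ψ : Additive (freeAbelianGroup X) B) →
                     (∀ i → Additive.fun φ [ Finite.rep fin i ] B.≈ Additive.fun ψ [ Finite.rep fin i ]) →
                     ∀ s → Additive.fun φ s B.≈ Additive.fun ψ s
  additive-ext-rep {X} fin φ ψ e = additive-ext B X φ ψ λ x →
    B.trans (Additive.cong φ (CombEq.[]-cong (Setoid.sym X (rep-class x))))
      (B.trans (e (class x)) (Additive.cong ψ (CombEq.[]-cong (rep-class x))))
    where open Finite fin

module _ {A₁ A₂ : AbelianGroup 0ℓ 0ℓ} (B : AbelianGroup 0ℓ 0ℓ) where
  private
    module A₁ = AbelianGroup A₁
    module A₂ = AbelianGroup A₂
    module B = AbelianGroup B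
    A₁×A₂ = DirectProduct.abelianGroup A₁ A₂

  copair : Additive A₁ B → Additive A₂ B → Additive A₁×A₂ B
  copair f₁ f₂ = record
    { fun  = λ (x , y) → f₁.fun x B.∙ f₂.fun y
    ; cong = λ (p , q) → B.∙-cong (f₁.cong p) (f₂.cong q)
    ; homo = λ (x , y) (x′ , y′) → B.trans (B.∙-cong (f₁.homo x x′) (f₂.homo y y′))
        (CommutativeSemigroupProperties.interchange B.commutativeSemigroup _ _ _ _)
    }
    where
    module f₁ = Additive f₁
    module f₂ = Additive f₂

  copair-inj₁ : ∀ f₁ f₂ x → Additive.fun (copair f₁ f₂) (x , A₂.ε) B.≈ Additive.fun f₁ x
  copair-inj₁ f₁ f₂ x = B.trans (B.∙-congˡ (Additive.ε-homo f₂)) (B.identityʳ _)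

  copair-inj₂ : ∀ f₁ f₂ y → Additive.fun (copair f₁ f₂) (A₁.ε , y) B.≈ Additive.fun f₂ y
  copair-inj₂ f₁ f₂ y = B.trans (B.∙-congʳ (Additive.ε-homo f₁)) (B.identityˡ _)

  product-ext : (φ ψ : Additive A₁×A₂ B) →
                (∀ x → Additive.fun φ (x , A₂.ε) B.≈ Additive.fun ψ (x , A₂.ε)) →
                (∀ y → Additive.fun φ (A₁.ε , y) B.≈ Additive.fun ψ (A₁.ε , y)) →
                ∀ p → Additive.fun φ p B.≈ Additive.fun ψ p
  product-ext φ ψ e₁ e₂ (x , y) = B.trans (split φ) (B.trans (B.∙-cong (e₁ x) (e₂ y)) (B.sym (split ψ)))
    where
    split : ∀ φ → Additive.fun φ (x , y) B.≈ Additive.fun φ (x , A₂.ε) B.∙ Additive.fun φ (A₁.ε , y)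
    split φ = B.trans (Additive.cong φ (A₁.sym (A₁.identityʳ x) , A₂.sym (A₂.identityˡ y)))
      (Additive.homo φ _ _)

inl : (A₁ A₂ : AbelianGroup 0ℓ 0ℓ) → Additive A₁ (DirectProduct.abelianGroup A₁ A₂)
inl A₁ A₂ = record
  { fun  = _, AbelianGroup.ε A₂
  ; cong = λ p → p , AbelianGroup.refl A₂
  ; homo = λ _ _ → AbelianGroup.refl A₁ , AbelianGroup.sym A₂ (AbelianGroup.identityˡ A₂ _)
  }

inr : (A₁ A₂ : AbelianGroup 0ℓ 0ℓ) → Additive A₂ (DirectProduct.abelianGroup A₁ A₂)
inr A₁ A₂ = record
  { fun  = AbelianGroup.ε A₁ ,_
  ; cong = λ p → AbelianGroup.refl A₁ , p
  ; homo = λ _ _ → AbelianGroup.sym A₁ (AbelianGroup.identityˡ A₁ _) , AbelianGroup.refl A₂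
  }

-- The case n = 2m + 1: generators and the action on them.

module Isomorphism (m : ℕ) where

  n : ℕ
  n = suc (m ℕ.* 2)

  private
    open Power (D n) using (_^_)
    open Affine n

    X₀ X₁ : Setoid 0ℓ 0ℓ
    X₀ = Cosets (D n) (⟨_⟩ (D n) σ)
    X₁ = Cosets (D n) (⟨_⟩ (D n) τ)

    module X₁ = Setoid X₁

    F = freeAbelianGroup (basis n)
    F₀ = freeAbelianGroup X₀
    F₁ = freeAbelianGroup X₁
    ℤ+ = ℤ.+-0-abelianGroup

    A = DirectProduct.abelianGroup F ℤ+
    B = DirectProduct.abelianGroup F₀ F₁
    module A = AbelianGroup A
    module B = AbelianGroup B

    L = M̃₊ n ⊞ ℤ-trivial n
    L′ = ℤ[D/⟨σ⟩] n ⊞ ℤ[D/⟨τ⟩] n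

    -- _⊞_ proves the group laws differently from DirectProduct.abelianGroup,
    -- so additive maps have to be repackaged between the two.
    αᴬ : Generator → Additive A A
    αᴬ i = record { fun = α.fun ; cong = α.cong ; homo = α.homo }
      where
      module α = Additive (elementᴬ L (letter i))

    βᴬ : Generator → Additive B B
    βᴬ i = record { fun = β.fun ; cong = β.cong ; homo = β.homo }
      where
      module β = Additive (elementᴬ L′ (letter i))

    module α i = Additive (αᴬ i)
    module β i = Additive (βᴬ i)

    x : ℤ → A.Carrier
    x i = [ w[ i ] ] , 0ℤ

    y z : A.Carrier
    y = [ w ] , 0ℤ
    z = 𝟘 , 1ℤ

    e₀ e₁ : B.Carrier
    e₀ = [ εʷ ] , 𝟘
    e₁ = [ τ ] , 𝟘

    u : ℤ → B.Carrier
    u a = 𝟘 , [ σ ^ a ]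

    x-cong : ∀ {i j} → i ≡ j [mod n ] → x i A.≈ x j
    x-cong p = CombEq.[]-cong (w[]-cong p) , ≡.refl

    fin₀ = finite-σ
    fin₁ = finite-τ

    -- Both elements equal their common representative. Equality of cosets thus reduces to comparing
    -- normal forms: signs for ⟨σ⟩, shifts modulo n for ⟨τ⟩.
    same-class : ∀ {X} (fin : Finite X) {g h} → Finite.class fin g ≡ Finite.class fin h → Setoid._≈_ X g h
    same-class {X} fin {g} {h} e = Setoid.trans X (Setoid.sym X (rep-class g))
      (Setoid.trans X (Setoid.reflexive X (≡.cong rep e)) (rep-class h))
      where open Finite fin

    φ-power : ∀ a → φ (σ ^ a) ≡ (Sign.+ , a)
    φ-power (+ k)    = ≡.trans (≡.cong φ (≡.sym (^ʷ≡^ℕ σ k))) (φ-σ^ k)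
    φ-power -[1+ k ] = ≡.cong (Group._⁻¹ affine) (φ-power (+ suc k))

    shift-coset : ∀ {g h} → proj₂ (φ g) ≡ proj₂ (φ h) [mod n ] → g X₁.≈ h
    shift-coset p = same-class fin₁ (residue-cong p)

    u-cong : ∀ {a b} → a ≡ b [mod n ] → u a B.≈ u b
    u-cong {a} {b} p = CombEq.refl , CombEq.[]-cong (shift-coset {σ ^ a} {σ ^ b}
      (≡.subst₂ (λ c d → proj₂ c ≡ proj₂ d [mod n ]) (≡.sym (φ-power a)) (≡.sym (φ-power b)) p))

    open Target m B e₀ e₁ u (λ a → u-cong (mod-n a)) hiding (n)
    open Source m A x y z (λ a → x-cong (mod-n a)) hiding (n)
    module PA = Progressions A

    -- Links the sum over `Fin n` in the definition of τ w to the progression sums used above.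
    Σw≈Σx : (M̃₊-Construction.Σw n , 0ℤ) A.≈ Σx
    Σw≈Σx = A.trans (PF.sum≈run (λ i → [ w[ i ] ]) 0ℤ n , ≡.refl) (along-homo (inl F ℤ+) next _ 0ℤ n)
      where
      module PF = Progressions F

    -- The class of a coset of ⟨σ⟩ is the sign of its normal form, which σ preserves and τ flips, so
    -- the four identities on e₀ and e₁ hold by computation.
    rotate-e₀ : β.fun σ′ e₀ B.≈ e₀
    rotate-e₀ = CombEq.[]-cong (same-class fin₀ ≡.refl) , CombEq.refl

    rotate-e₁ : β.fun σ′ e₁ B.≈ e₁
    rotate-e₁ = CombEq.[]-cong (same-class fin₀ ≡.refl) , CombEq.refl

    rotate-u : ∀ a → β.fun σ′ (u a) B.≈ u (next a)
    rotate-u a = CombEq.refl , CombEq.[]-cong (shift-coset {σ ∙ʷ σ ^ a} {σ ^ next a} (mod-reflexive (≡.trans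
      (≡.cong (λ c → 1ℤ ℤ.+ proj₂ c) (φ-power a))
      (≡.trans (ℤ.+-comm 1ℤ a) (≡.cong proj₂ (≡.sym (φ-power (next a))))))))

    reflect-e₀ : β.fun τ′ e₀ B.≈ e₁
    reflect-e₀ = CombEq.[]-cong (same-class fin₀ ≡.refl) , CombEq.refl

    reflect-e₁ : β.fun τ′ e₁ B.≈ e₀
    reflect-e₁ = CombEq.[]-cong (same-class fin₀ ≡.refl) , CombEq.refl

    reflect-u : ∀ a → β.fun τ′ (u a) B.≈ u (ℤ.- a)
    reflect-u a = CombEq.refl , CombEq.[]-cong (shift-coset {τ ∙ʷ σ ^ a} {σ ^ (ℤ.- a)} (mod-reflexive (≡.trans
      (≡.cong (λ c → 0ℤ ℤ.+ ℤ.- proj₂ c) (φ-power a))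
      (≡.trans (ℤ.+-identityˡ (ℤ.- a)) (≡.cong proj₂ (≡.sym (φ-power (ℤ.- a))))))))

    open Rotation (βᴬ σ′) rotate-e₀ rotate-e₁ rotate-u
    open Reflection (βᴬ τ′) reflect-e₀ reflect-e₁ reflect-u

    -- The two additive maps and their values on generators.

    f-basis : Basis → B.Carrier
    f-basis w[ i ] = ω i
    f-basis w      = e₀ B.∙ ζ

    ω-cong : ∀ {i j} → i ≡ j [mod n ] → ω i B.≈ ω j
    ω-cong p = B.∙-congʳ (B.∙-cong (u-cong (mod-+ p (mod-reflexive ≡.refl)))
      (u-cong (mod-+ (mod-+ p (mod-reflexive ≡.refl)) (mod-reflexive ≡.refl))))

    f₁ : Additive F B
    f₁ = extendᴬ B (basis n) f-basis λ where
      (w[]-cong p) → ω-cong p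
      w-refl       → B.refl

    f : Additive A B
    f = copair B f₁ (powers B ζ)

    module f = Additive f

    f-x : ∀ i → f.fun (x i) B.≈ ω i
    f-x i = copair-inj₁ B f₁ (powers B ζ) [ w[ i ] ]

    f-y : f.fun y B.≈ e₀ B.∙ ζ
    f-y = copair-inj₁ B f₁ (powers B ζ) [ w ]

    f-z : f.fun z B.≈ ζ
    f-z = B.trans (copair-inj₂ B f₁ (powers B ζ) 1ℤ) (B.identityʳ ζ)

    sign-value : Sign → A.Carrier
    sign-value Sign.+ = ε₀
    sign-value Sign.- = ε₁

    υ-cong : ∀ {i j} → i ≡ j [mod n ] → υ i A.≈ υ j
    υ-cong {i} {j} p = A.∙-congˡ {z} (A.⁻¹-cong (stride-cong (mod-+ (mod-+ p (mod-reflexive ≡.refl)) (mod-reflexive ≡.refl)) m))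
      where
      stride-cong : ∀ {a b} → a ≡ b [mod n ] → ∀ k → PA.stride x a k A.≈ PA.stride x b k
      stride-cong p zero    = A.refl
      stride-cong p (suc k) = A.∙-cong (x-cong p)
        (stride-cong (mod-+ (mod-+ p (mod-reflexive ≡.refl)) (mod-reflexive ≡.refl)) k)

    g₀ : Additive F₀ A
    g₀ = extendᴬ A X₀ (sign-value ∘ proj₁ ∘ φ) λ {g} {h} p → A.reflexive (≡.cong sign-value (≡.sym (≡.trans
      (proj₁ (φ-recover g h))
      (≡.trans (≡.cong (proj₁ (φ g) Sign.*_) (sign-⟨σ⟩ p)) (Sign.*-identityʳ (proj₁ (φ g)))))))

    g₁ : Additive F₁ A
    -- `class-cong` yields equal residues in `Fin n`; `residue-≡` at both ends turns this into a
    -- congruence of the shifts.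
    g₁ = extendᴬ A X₁ (υ ∘ proj₂ ∘ φ) λ {g} {h} p → υ-cong {proj₂ (φ g)} {proj₂ (φ h)} (mod-trans (mod-sym (residue-≡ (proj₂ (φ g))))
      (mod-trans (mod-reflexive (≡.cong (+_ ∘ toℕ) (Finite.class-cong fin₁ {g} {h} p))) (residue-≡ (proj₂ (φ h)))))

    g : Additive B A
    g = copair A g₀ g₁

    module g = Additive g

    g-e₀ : g.fun e₀ A.≈ ε₀
    g-e₀ = copair-inj₁ A g₀ g₁ [ εʷ ]

    g-e₁ : g.fun e₁ A.≈ ε₁
    g-e₁ = copair-inj₁ A g₀ g₁ [ τ ]

    g-u : ∀ a → g.fun (u a) A.≈ υ a
    g-u a = A.trans (copair-inj₂ A g₀ g₁ [ σ ^ a ]) (A.reflexive (≡.cong (υ ∘ proj₂) (φ-power a)))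

    -- Inversion and equivariance on the whole lattices.

    open Exchange m A B x y z (λ a → x-cong (mod-n a)) e₀ e₁ u (λ a → u-cong (mod-n a))

    maps : Maps
    maps = record
      { f = f ; g = g ; f-x = f-x ; f-y = f-y ; f-z = f-z ; g-e₀ = g-e₀ ; g-e₁ = g-e₁ ; g-u = g-u }

    open Maps maps using (f-τy; f∘g-e₀; f∘g-e₁; f∘g-u; g-ζ; g∘f-x; g∘f-y)

    f∘g : ∀ p → f.fun (g.fun p) B.≈ p
    f∘g = product-ext B (f ∘ᴬ g) idᴬ
      (additive-ext-rep B fin₀ ((f ∘ᴬ g) ∘ᴬ inl F₀ F₁) (inl F₀ F₁) λ where
        zero       → f∘g-e₀
        (suc zero) → f∘g-e₁)
      (additive-ext-rep B fin₁ ((f ∘ᴬ g) ∘ᴬ inr F₀ F₁) (inr F₀ F₁) (λ i → f∘g-u (+ toℕ i)))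

    g∘f : ∀ p → g.fun (f.fun p) A.≈ p
    g∘f = product-ext A (g ∘ᴬ f) idᴬ
      (additive-ext A (basis n) ((g ∘ᴬ f) ∘ᴬ inl F ℤ+) (inl F ℤ+) λ where
        w[ i ] → g∘f-x i
        w      → g∘f-y)
      (ℤ-additive-ext A ((g ∘ᴬ f) ∘ᴬ inr F ℤ+) (inr F ℤ+) (A.trans (g.cong f-z) g-ζ))

    f-equivariant : ∀ i p → f.fun (α.fun i p) B.≈ β.fun i (f.fun p)
    f-equivariant i = product-ext B (f ∘ᴬ αᴬ i) (βᴬ i ∘ᴬ f)
      (additive-ext B (basis n) ((f ∘ᴬ αᴬ i) ∘ᴬ inl F ℤ+) ((βᴬ i ∘ᴬ f) ∘ᴬ inl F ℤ+) (on-basis i))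
      (ℤ-additive-ext B ((f ∘ᴬ αᴬ i) ∘ᴬ inr F ℤ+) ((βᴬ i ∘ᴬ f) ∘ᴬ inr F ℤ+)
        (on-z i))
      where
      on-z : ∀ i → f.fun (α.fun i z) B.≈ β.fun i (f.fun z)
      on-z σ′ = B.trans f-z (B.sym (B.trans (β.cong σ′ f-z) rotate-ζ))
      on-z τ′ = B.trans f-z (B.sym (B.trans (β.cong τ′ f-z) reflect-ζ))
      on-basis : ∀ i b → f.fun (α.fun i ([ b ] , 0ℤ)) B.≈ β.fun i (f.fun ([ b ] , 0ℤ))
      on-basis σ′ w[ i ] = B.trans (f-x (next i)) (B.sym (B.trans (β.cong σ′ (f-x i)) (rotate-ω i)))
      on-basis σ′ w      = B.trans f-y (B.sym (B.trans (β.cong σ′ f-y)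
        rotate-e₀∙ζ))
      on-basis τ′ w[ i ] = B.trans (f-x (ℤ.- i)) (B.sym (B.trans (β.cong τ′ (f-x i)) (reflect-ω i)))
      -- Here τ w computes to -w + Σw, which is first put in the form required by `f-τy`.
      on-basis τ′ w      = B.trans (B.trans (f.cong (A.∙-congˡ {y A.⁻¹} Σw≈Σx)) f-τy)
        (B.sym (B.trans (β.cong τ′ f-y) reflect-e₀∙ζ))

  isomorphism : M̃₊ n ⊞ ℤ-trivial n ≅ ℤ[D/⟨σ⟩] n ⊞ ℤ[D/⟨τ⟩] n
  isomorphism = ≅-intro L L′ record { fun = f.fun ; cong = f.cong ; homo = f.homo } f-equivariant
    record { fun = g.fun ; cong = g.cong ; homo = g.homo } f∘g g∘f

-- Reduction of odd n to the form 2m + 1.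

odd-form : ∀ n → 2 ∤ n → ∃[ m ] n ≡ suc (m ℕ.* 2)
odd-form n 2∤n with n ℕ.% 2 in e | ℕ.m≡m%n+[m/n]*n n 2 | ℕ.m%n<n n 2
... | 0           | _ | _ = contradiction (m%n≡0⇒n∣m n 2 e) 2∤n
... | 1           | p | _ = n ℕ./ 2 , p
... | suc (suc _) | _ | ℕ.s≤s (ℕ.s≤s ())

theorem3p4 : (n : ℕ) .{{_ : NonZero n}} → 3 ≤ n → 2 ∤ n →
    M̃₊ n ⊞ ℤ-trivial n ≅ ℤ[D/⟨σ⟩] n ⊞ ℤ[D/⟨τ⟩] n
theorem3p4 n _ 2∤n with odd-form n 2∤n
... | m , ≡.refl = Isomorphism.isomorphism m
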